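{- Let $\mathbf{a}$ be a weak $m$-part composition of $n$ and let $t=(k,l)$ be a lattice point (with $0\le l\le m$) dominated by all cyclic shifts of $\mathbf{a}$. Then for every integer $c$, $$|\mathscr{G}_t(\mathbf{a})\cap\mathscr{C}^{c}| = m\binom{k}{c}\binom{l}{c}-n\binom{k-1}{c-1}\binom{l+1}{c+1}.$$
   Context: Lattice paths use unit steps $(0,1)$ (up) and $(1,0)$ (right). $\mathbf{a}=(a_0,\ldots,a_{m-1})$ is a tuple of nonnegative integers summing to $n$; indices read mod $m$. Let $f_{\mathbf{a}}(y)=a_r(y-r)+\sum_{j=0}^{r-1}a_j$ for $y\in[r,r+1]$, $0\le r<m$. A lattice point $(x,y)$ with $0\le y\le m$ is dominated by $\mathbf{a}$ if $x\ge f_{\mathbf{a}}(y)$; a path is dominated if all its lattice points are. Cyclic shifts: $\mathbf{a}^{j}=(a_{ -j},\ldots,a_{ -j+m-1})$. An LPBP is a pair $(P,(\mathbf{a},j))$ with $P$ a lattice path from the origin and $0\le j<m$; it is good if $P$ is dominated by $\mathbf{a}^j$. $\mathscr{G}_t(\mathbf{a})$ is the set of good LPBPs whose path ends at $t$. An up-right corner of a path is a point at which an up step ends and is immediately followed by a right step; $\mathscr{C}^{c}$ is the set of LPBPs whose path has exactly $c$ up-right corners. -}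

module Defs where

open import Data.Nat using (ℕ; zero; suc; _+_; _≤_; NonZero)
open import Data.Nat.DivMod using (_mod_)
open import Data.Nat.Combinatorics using (_C_)
open import Data.Fin using (Fin; toℕ)
open import Data.List using (List; []; _∷_; take; tabulate)
open import Data.Nat.ListAction using (sum)
open import Data.List.Relation.Unary.All using (All)
open import Data.Product using (_×_; _,_)
open import Data.Integer using (ℤ; +_)
import Data.Nat
import Relation.Binary.PropositionalEquality

data Step : Set where
  up right : Step

pointsFrom : ℕ × ℕ → List Step → List (ℕ × ℕ)
pointsFrom p [] = p ∷ []
pointsFrom (x , y) (up ∷ s) = (x , y) ∷ pointsFrom (x , suc y) s
pointsFrom (x , y) (right ∷ s) = (x , y) ∷ pointsFrom (suc x , y) s

points : List Step → List (ℕ × ℕ)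
points = pointsFrom (0 , 0)

endFrom : ℕ × ℕ → List Step → ℕ × ℕ
endFrom p [] = p
endFrom (x , y) (up ∷ s) = endFrom (x , suc y) s
endFrom (x , y) (right ∷ s) = endFrom (suc x , y) s

endpoint : List Step → ℕ × ℕ
endpoint = endFrom (0 , 0)

corners : List Step → ℕ
corners [] = 0
corners (up ∷ right ∷ s) = suc (corners (right ∷ s))
corners (_ ∷ s) = corners s

f : {m : ℕ} → (Fin m → ℕ) → ℕ → ℕ
f a y = sum (take y (tabulate a))

DominatedPt : {m : ℕ} → (Fin m → ℕ) → ℕ × ℕ → Set
DominatedPt {m} a (x , y) = (y ≤ m) × (f a y ≤ x)

DominatedPath : {m : ℕ} → (Fin m → ℕ) → List Step → Set
DominatedPath a P = All (DominatedPt a) (points P)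

-- Cyclic shift a^j = (a_{-j}, ..., a_{-j+m-1}), i.e. (a^j)_i = a_{(i - j) mod m}.
shift : {m : ℕ} → .{{_ : NonZero m}} → (Fin m → ℕ) → Fin m → (Fin m → ℕ)
shift {m} a j i = a ((toℕ i + (m Data.Nat.∸ toℕ j)) mod m)

GoodCorners : (m : ℕ) → .{{_ : NonZero m}} → (Fin m → ℕ) → ℕ × ℕ → ℤ → Set
GoodCorners m a t c =
  Data.Product.Σ (List Step × Fin m) λ where
    (P , j) → (endpoint P Relation.Binary.PropositionalEquality.≡ t)
            × DominatedPath (shift a j) P
            × ((+ corners P) Relation.Binary.PropositionalEquality.≡ c)

binomℤ : ℤ → ℤ → ℤ
binomℤ (+ n) (+ k) = + (n C k)
binomℤ _ _ = + 0

-- A path is given by its up-right corners, a chain strictly increasing in both coordinates;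
-- it is dominated iff all its corners are. Consider the first bad corner (x , y). Its abscissa
-- lies over one unit of the composition, belonging to a part in some row q ≤ y, and the corners
-- before it lie strictly below row q. Deleting x from the abscissas, inserting q among the
-- ordinates (after raising y and the later ones by one, since q ≤ y) and reading the corners before (x , y) backwards from (x , q) leaves that unit
-- together with an arbitrary choice of c - 1 out of k - 1 abscissas and of c + 1 out of l + 1
-- ordinates: the splitting point is recovered as the first abscissa that exceeds the boundary
-- read backwards from the unit. Over all cyclic shifts every unit occurs exactly once for
-- every q, so there are n (k-1 choose c-1) (l+1 choose c+1) bad pairs.

module Submission where

open import Defs
open import Axiom.UniquenessOfIdentityProofs.WithK using (uip)
open import Data.Empty using (⊥-elim)
open import Data.Fin using (Fin; zero; suc; toℕ; fromℕ<)
open import Data.Fin.Properties using (+↔⊎; toℕ<n; toℕ-fromℕ<; toℕ-injective)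
open import Data.List using (List; []; _∷_; tabulate; take)
open import Data.List.Relation.Unary.All as All using (All; []; _∷_)
open import Data.Nat using (ℕ; zero; suc; _≤_; NonZero; z≤n; s≤s)
open import Data.Nat.Combinatorics using (_C_; nCk+nC[k+1]≡[n+1]C[k+1]; k>n⇒nCk≡0)
open import Data.Nat.DivMod using (_%_; _/_; _mod_; m%n<n; [m+n]%n≡m%n; m<n⇒m%n≡m; m≡m%n+[m/n]*n)
open import Data.Nat.ListAction using (sum)
open import Data.Product using (Σ; _×_; _,_; proj₁; proj₂)
open import Data.Sum using (_⊎_; inj₁; inj₂)
open import Data.Sum.Function.Propositional using (_⊎-↔_)
open import Function using (_∘_)
open import Function.Bundles using (_↔_; mk↔ₛ′)
open import Function.Properties.Inverse using (↔-trans; ↔-sym)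
open import Relation.Nullary using (¬_; Dec; yes; no; Irrelevant)
open import Relation.Binary.PropositionalEquality using (_≡_; refl; sym; trans; cong; cong₂; subst; module ≡-Reasoning)

module Counting where
  open import Data.Nat using (_+_; _*_; _∸_; _<_; _≤?_; _<?_; _≟_)
  open import Data.Nat.Properties
  open import Data.Nat.Tactic.RingSolver using (solve-∀)

  -- Finite sums

  ∑ : ℕ → (ℕ → ℕ) → ℕ
  ∑ zero    f = 0
  ∑ (suc n) f = f 0 + ∑ n (λ i → f (suc i))

  syntax ∑ n (λ i → e) = ∑[ i < n ] e
  infixr 6.6 ∑

  ∑-cong< : ∀ n {f g : ℕ → ℕ} → (∀ i → i < n → f i ≡ g i) → ∑ n f ≡ ∑ n g
  ∑-cong< zero    e = refl
  ∑-cong< (suc n) e = cong₂ _+_ (e 0 (s≤s z≤n)) (∑-cong< n λ i i<n → e (suc i) (s≤s i<n))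

  ∑-cong : ∀ n {f g : ℕ → ℕ} → (∀ i → f i ≡ g i) → ∑ n f ≡ ∑ n g
  ∑-cong n e = ∑-cong< n λ i _ → e i

  ∑-const : ∀ n c → ∑[ i < n ] c ≡ n * c
  ∑-const zero    c = refl
  ∑-const (suc n) c = cong (c +_) (∑-const n c)

  ∑-zero : ∀ n {f : ℕ → ℕ} → (∀ i → i < n → f i ≡ 0) → ∑ n f ≡ 0
  ∑-zero n e = trans (∑-cong< n e) (trans (∑-const n 0) (*-zeroʳ n))

  ∑-+ : ∀ n (f g : ℕ → ℕ) → ∑[ i < n ] (f i + g i) ≡ ∑ n f + ∑ n g
  ∑-+ zero    f g = refl
  ∑-+ (suc n) f g = trans (cong (f 0 + g 0 +_) (∑-+ n _ _)) (lemma (f 0) (g 0) _ _)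
    where
    lemma : ∀ a b c d → a + b + (c + d) ≡ a + c + (b + d)
    lemma = solve-∀

  ∑-*ˡ : ∀ n c (f : ℕ → ℕ) → ∑[ i < n ] (c * f i) ≡ c * ∑ n f
  ∑-*ˡ zero    c f = sym (*-zeroʳ c)
  ∑-*ˡ (suc n) c f = trans (cong (c * f 0 +_) (∑-*ˡ n c _)) (sym (*-distribˡ-+ c (f 0) _))

  ∑-*ʳ : ∀ n c (f : ℕ → ℕ) → ∑[ i < n ] (f i * c) ≡ ∑ n f * c
  ∑-*ʳ n c f = trans (∑-cong n λ i → *-comm (f i) c) (trans (∑-*ˡ n c f) (*-comm c _))

  ∑-swap : ∀ m n (f : ℕ → ℕ → ℕ) → ∑[ i < m ] ∑[ j < n ] f i j ≡ ∑[ j < n ] ∑[ i < m ] f i j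
  ∑-swap zero    n f = sym (∑-zero n λ _ _ → refl)
  ∑-swap (suc m) n f = trans (cong (∑ n (f 0) +_) (∑-swap m n _)) (sym (∑-+ n (f 0) _))

  ∑-split : ∀ m n (f : ℕ → ℕ) → ∑ (m + n) f ≡ ∑ m f + ∑[ i < n ] f (m + i)
  ∑-split zero    n f = refl
  ∑-split (suc m) n f = trans (cong (f 0 +_) (∑-split m n _)) (sym (+-assoc (f 0) _ _))

  ∑-last : ∀ n (f : ℕ → ℕ) → ∑ (suc n) f ≡ ∑ n f + f n
  ∑-last n f = begin
    ∑ (suc n) f                      ≡⟨ cong (λ k → ∑ k f) (+-comm 1 n) ⟩
    ∑ (n + 1) f                      ≡⟨ ∑-split n 1 f ⟩
    ∑ n f + (f (n + 0) + 0)          ≡⟨ cong (∑ n f +_) (trans (+-identityʳ _) (cong f (+-identityʳ n))) ⟩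
    ∑ n f + f n ∎
    where open ≡-Reasoning

  ∑-reverse : ∀ n (f : ℕ → ℕ) → ∑ n f ≡ ∑[ i < n ] f (n ∸ suc i)
  ∑-reverse zero    f = refl
  ∑-reverse (suc n) f = begin
    ∑ (suc n) f                         ≡⟨ ∑-last n f ⟩
    ∑ n f + f n                         ≡⟨ +-comm _ (f n) ⟩
    f n + ∑ n f                         ≡⟨ cong (f n +_) (∑-reverse n f) ⟩
    f n + ∑[ i < n ] f (n ∸ suc i) ∎
    where open ≡-Reasoning

  ∑-mono : ∀ (f : ℕ → ℕ) {m n} → m ≤ n → ∑ m f ≤ ∑ n f
  ∑-mono f z≤n       = z≤n
  ∑-mono f (s≤s m≤n) = +-monoʳ-≤ (f 0) (∑-mono _ m≤n)

  -- Indicators and guarded sums.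

  ⟦_⟧ : {P : Set} → Dec P → ℕ
  ⟦ yes _ ⟧ = 1
  ⟦ no _ ⟧  = 0

  ⟦⟧-true : {P : Set} (P? : Dec P) → P → ⟦ P? ⟧ ≡ 1
  ⟦⟧-true (yes _) _ = refl
  ⟦⟧-true (no ¬p) p = ⊥-elim (¬p p)

  ⟦⟧-false : {P : Set} (P? : Dec P) → ¬ P → ⟦ P? ⟧ ≡ 0
  ⟦⟧-false (yes p) ¬p = ⊥-elim (¬p p)
  ⟦⟧-false (no _)  _  = refl

  ⟦⟧-⇔ : {P Q : Set} (P? : Dec P) (Q? : Dec Q) → (P → Q) → (Q → P) → ⟦ P? ⟧ ≡ ⟦ Q? ⟧
  ⟦⟧-⇔ (yes p) Q? to from = sym (⟦⟧-true Q? (to p))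
  ⟦⟧-⇔ (no ¬p) Q? to from = sym (⟦⟧-false Q? λ q → ¬p (from q))

  ⟦⟧-true-* : {P : Set} (P? : Dec P) → P → ∀ x → ⟦ P? ⟧ * x ≡ x
  ⟦⟧-true-* P? p x = trans (cong (_* x) (⟦⟧-true P? p)) (*-identityˡ x)

  ⟦⟧-false-* : {P : Set} (P? : Dec P) → ¬ P → ∀ x → ⟦ P? ⟧ * x ≡ 0
  ⟦⟧-false-* P? ¬p x = cong (_* x) (⟦⟧-false P? ¬p)

  ⟦⟧-cong-* : {P : Set} (P? : Dec P) {x y : ℕ} → (P → x ≡ y) → ⟦ P? ⟧ * x ≡ ⟦ P? ⟧ * y
  ⟦⟧-cong-* (yes p) e = cong (1 *_) (e p)
  ⟦⟧-cong-* (no _)  e = refl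

  -- Constraints on indices are carried as indicator factors over a fixed range, so that sums can be
  -- exchanged freely; this turns such a factor back into a range.
  ∑-below : ∀ {m n} → m ≤ n → (f : ℕ → ℕ) → ∑[ i < n ] (⟦ i <? m ⟧ * f i) ≡ ∑ m f
  ∑-below {m} {n} m≤n f = begin
    ∑ n h                                ≡⟨ cong (λ k → ∑ k h) (m+[n∸m]≡n m≤n) ⟨
    ∑ (m + (n ∸ m)) h                    ≡⟨ ∑-split m (n ∸ m) h ⟩
    ∑ m h + ∑[ i < n ∸ m ] h (m + i)     ≡⟨ cong₂ _+_ (∑-cong< m λ i i<m → ⟦⟧-true-* (i <? m) i<m (f i))
                                              (∑-zero (n ∸ m) λ i _ → ⟦⟧-false-* (m + i <? m) (m+n≮m m i) _) ⟩
    ∑ m f + 0                            ≡⟨ +-identityʳ _ ⟩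
    ∑ m f ∎
    where
    open ≡-Reasoning
    h : ℕ → ℕ
    h i = ⟦ i <? m ⟧ * f i

  ∑-from : ∀ m n (f : ℕ → ℕ) → ∑[ i < m + n ] (⟦ m ≤? i ⟧ * f i) ≡ ∑[ i < n ] f (m + i)
  ∑-from m n f = trans (∑-split m n _) (cong₂ _+_
    (∑-zero m λ i i<m → ⟦⟧-false-* (m ≤? i) (<⇒≱ i<m) (f i))
    (∑-cong n λ i → ⟦⟧-true-* (m ≤? m + i) (m≤m+n m i) _))

  ∑-from-≥ : ∀ {m n} → n ≤ m → (f : ℕ → ℕ) → ∑[ i < n ] (⟦ m ≤? i ⟧ * f i) ≡ 0
  ∑-from-≥ {m} {n} n≤m f = ∑-zero n λ i i<n → ⟦⟧-false-* (m ≤? i) (<⇒≱ (<-≤-trans i<n n≤m)) (f i)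

  ∑-from-head : ∀ {m n} → m < n → (f : ℕ → ℕ) →
    ∑[ i < n ] (⟦ m ≤? i ⟧ * f i) ≡ f m + ∑[ i < n ] (⟦ suc m ≤? i ⟧ * f i)
  ∑-from-head {m} {n} m<n f = begin
    ∑ n (h m)                                ≡⟨ cong (λ k → ∑ k (h m)) eq ⟨
    ∑ (m + suc d) (h m)                      ≡⟨ ∑-from m (suc d) f ⟩
    f (m + 0) + ∑[ i < d ] f (m + suc i)     ≡⟨ cong₂ _+_ (cong f (+-identityʳ m)) (∑-cong d λ i → cong f (+-suc m i)) ⟩
    f m + ∑[ i < d ] f (suc m + i)           ≡⟨ cong (f m +_) (∑-from (suc m) d f) ⟨
    f m + ∑ (suc m + d) (h (suc m))          ≡⟨ cong (λ k → f m + ∑ k (h (suc m))) (m+[n∸m]≡n m<n) ⟩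
    f m + ∑ n (h (suc m)) ∎
    where
    open ≡-Reasoning
    h : ℕ → ℕ → ℕ
    h a i = ⟦ a ≤? i ⟧ * f i
    d = n ∸ suc m
    eq : m + suc d ≡ n
    eq = trans (+-suc m d) (m+[n∸m]≡n m<n)

  -- The reflection of `i` to `n ∸ suc i` trades an upper bound for a lower one. This is what
  -- reverses chains later on.
  ∑-flip : ∀ n a (f : ℕ → ℕ) → ∑ (n ∸ a) f ≡ ∑[ i < n ] (⟦ a ≤? i ⟧ * f (n ∸ suc i))
  ∑-flip n a f = begin
    ∑ (n ∸ a) f                                          ≡⟨ ∑-below (m∸n≤m n a) f ⟨
    ∑[ i < n ] (⟦ i <? n ∸ a ⟧ * f i)                     ≡⟨ ∑-reverse n _ ⟩
    ∑[ i < n ] (⟦ n ∸ suc i <? n ∸ a ⟧ * f (n ∸ suc i))   ≡⟨ ∑-cong< n (λ i i<n → cong (_* f (n ∸ suc i))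
                                                              (⟦⟧-⇔ (n ∸ suc i <? n ∸ a) (a ≤? i) (to i) (from i i<n))) ⟩
    ∑[ i < n ] (⟦ a ≤? i ⟧ * f (n ∸ suc i)) ∎
    where
    open ≡-Reasoning
    to : ∀ i → n ∸ suc i < n ∸ a → a ≤ i
    to i lt = ≮⇒≥ λ i<a → <⇒≱ lt (∸-monoʳ-≤ n i<a)
    from : ∀ i → i < n → a ≤ i → n ∸ suc i < n ∸ a
    from i i<n a≤i = ∸-monoʳ-< (s≤s a≤i) i<n

  ∑∑-+ : ∀ m n (f g : ℕ → ℕ → ℕ) → ∑[ i < m ] ∑[ j < n ] (f i j + g i j) ≡
    (∑[ i < m ] ∑[ j < n ] f i j) + (∑[ i < m ] ∑[ j < n ] g i j)
  ∑∑-+ m n f g = trans (∑-cong m λ i → ∑-+ n (f i) (g i)) (∑-+ m _ _)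

  -- Binomial sums

  nC0≡1 : ∀ n → n C 0 ≡ 1
  nC0≡1 zero    = refl
  nC0≡1 (suc n) = refl

  0C[1+r]≡0 : ∀ r → 0 C suc r ≡ 0
  0C[1+r]≡0 r = k>n⇒nCk≡0 {0} {suc r} (s≤s z≤n)

  -- Sort the subsets of size `r + 1` of the interval from `a` to `n - 1` by their least element
  -- `x`.
  hockey-stick : ∀ n a r → ∑[ x < n ] (⟦ a ≤? x ⟧ * ((n ∸ suc x) C r)) ≡ (n ∸ a) C suc r
  hockey-stick zero    a       r = sym (trans (cong (_C suc r) (0∸n≡0 a)) (0C[1+r]≡0 r))
  hockey-stick (suc n) zero    r = begin
    1 * (n C r) + ∑[ x < n ] (⟦ 0 ≤? suc x ⟧ * ((n ∸ suc x) C r))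
      ≡⟨ cong₂ _+_ (*-identityˡ _) (hockey-stick n 0 r) ⟩
    n C r + n C suc r                ≡⟨ nCk+nC[k+1]≡[n+1]C[k+1] n r ⟩
    suc n C suc r ∎
    where open ≡-Reasoning
  hockey-stick (suc n) (suc a) r = trans
    (∑-cong n λ x → cong (_* ((n ∸ suc x) C r)) (⟦⟧-⇔ (suc a ≤? suc x) (a ≤? x) ≤-pred s≤s))
    (hockey-stick n a r)

  hockey-stick₀ : ∀ n r → ∑[ x < n ] ((n ∸ suc x) C r) ≡ n C suc r
  hockey-stick₀ n r = trans (∑-cong n λ x → sym (⟦⟧-true-* (0 ≤? x) z≤n _)) (hockey-stick n 0 r)

  -- A summand for `x = n` can be added, since `0 C suc r` vanishes; hence the lower index is a
  -- successor here.
  hockey-stick′ : ∀ n a r → ∑[ x < n ] (⟦ a ≤? x ⟧ * ((n ∸ x) C suc r)) ≡ (suc n ∸ a) C suc (suc r)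
  hockey-stick′ n a r = begin
    ∑ n h                                ≡⟨ +-identityʳ _ ⟨
    ∑ n h + 0                            ≡⟨ cong (∑ n h +_) h[n]≡0 ⟨
    ∑ n h + h n                          ≡⟨ ∑-last n h ⟨
    ∑ (suc n) h                          ≡⟨ hockey-stick (suc n) a (suc r) ⟩
    (suc n ∸ a) C suc (suc r) ∎
    where
    open ≡-Reasoning
    h : ℕ → ℕ
    h x = ⟦ a ≤? x ⟧ * ((n ∸ x) C suc r)
    h[n]≡0 : h n ≡ 0
    h[n]≡0 = trans (cong (⟦ a ≤? n ⟧ *_) (trans (cong (_C suc r) (n∸n≡0 n)) (0C[1+r]≡0 r))) (*-zeroʳ ⟦ a ≤? n ⟧)

  -- The least element of a subset of size `r + 1` is either below `b`, or the whole subset lies at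
  -- or above `b`.
  hockey-stick-partial : ∀ {n a b} r → a ≤ b → b ≤ n →
    ∑[ x < b ] (⟦ a ≤? x ⟧ * ((n ∸ suc x) C r)) + (n ∸ b) C suc r ≡ (n ∸ a) C suc r
  hockey-stick-partial {n} {a} {b} r a≤b b≤n = begin
    ∑ b h + (n ∸ b) C suc r                  ≡⟨ cong (∑ b h +_) tail ⟨
    ∑ b h + ∑[ x < n ∸ b ] h (b + x)         ≡⟨ ∑-split b (n ∸ b) h ⟨
    ∑ (b + (n ∸ b)) h                        ≡⟨ cong (λ k → ∑ k h) (m+[n∸m]≡n b≤n) ⟩
    ∑ n h                                    ≡⟨ hockey-stick n a r ⟩
    (n ∸ a) C suc r ∎
    where
    open ≡-Reasoning
    h : ℕ → ℕ
    h x = ⟦ a ≤? x ⟧ * ((n ∸ suc x) C r)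
    tail : ∑[ x < n ∸ b ] h (b + x) ≡ (n ∸ b) C suc r
    tail = trans
      (∑-cong (n ∸ b) λ x → trans
        (⟦⟧-true-* (a ≤? b + x) (≤-trans a≤b (m≤m+n b x)) _)
        (cong (_C r) (trans (cong (n ∸_) (sym (+-suc b x))) (sym (∸-+-assoc n b (suc x))))))
      (hockey-stick₀ (n ∸ b) r)

  ∑-triangle : ∀ k (f : ℕ → ℕ → ℕ) →
    ∑[ x < k ] ∑[ x′ < x ] f x′ x ≡ ∑[ x′ < k ] ∑[ x < k ] (⟦ suc x′ ≤? x ⟧ * f x′ x)
  ∑-triangle k f = trans
    (∑-cong< k λ x x<k → sym (∑-below (<⇒≤ x<k) λ x′ → f x′ x))
    (∑-swap k k _)

  -- Chains of good points

  upper : ℕ → ℕ → (ℕ → ℕ → ℕ) → ℕ → ℕ → ℕ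
  upper k l w a b = ∑[ x < k ] (⟦ a ≤? x ⟧ * (∑[ y < l ] (⟦ b ≤? y ⟧ * w x y)))

  upper-*ˡ : ∀ k l c (w : ℕ → ℕ → ℕ) a b → upper k l (λ x y → c * w x y) a b ≡ c * upper k l w a b
  upper-*ˡ k l c w a b = trans
    (∑-cong k λ x → trans
      (cong (⟦ a ≤? x ⟧ *_) (trans
        (∑-cong l λ y → rearrange ⟦ b ≤? y ⟧ c (w x y))
        (∑-*ˡ l c _)))
      (rearrange ⟦ a ≤? x ⟧ c _))
    (∑-*ˡ k c _)
    where
    rearrange : ∀ p q r → p * (q * r) ≡ q * (p * r)
    rearrange = solve-∀

  ∑∑-triangle : ∀ k l (f : ℕ → ℕ → ℕ → ℕ → ℕ) →
    ∑[ x < k ] ∑[ y < l ] ∑[ x′ < x ] ∑[ y′ < y ] f x′ y′ x y ≡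
    ∑[ x′ < k ] ∑[ y′ < l ] upper k l (f x′ y′) (suc x′) (suc y′)
  ∑∑-triangle k l f = begin
    ∑[ x < k ] ∑[ y < l ] ∑[ x′ < x ] ∑[ y′ < y ] f x′ y′ x y
      ≡⟨ ∑-cong k (λ x → ∑-swap l x _) ⟩
    ∑[ x < k ] ∑[ x′ < x ] ∑[ y < l ] ∑[ y′ < y ] f x′ y′ x y
      ≡⟨ ∑-triangle k _ ⟩
    ∑[ x′ < k ] ∑[ x < k ] (⟦ suc x′ ≤? x ⟧ * (∑[ y < l ] ∑[ y′ < y ] f x′ y′ x y))
      ≡⟨ ∑-cong k (λ x′ → trans
           (∑-cong k λ x → trans
             (cong (⟦ suc x′ ≤? x ⟧ *_) (∑-triangle l λ y′ y → f x′ y′ x y))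
             (sym (∑-*ˡ l ⟦ suc x′ ≤? x ⟧ _)))
           (∑-swap k l _)) ⟩
    ∑[ x′ < k ] ∑[ y′ < l ] upper k l (f x′ y′) (suc x′) (suc y′) ∎
    where open ≡-Reasoning

  -- The point (x , y) stands for the potential corner (x , y + 1).
  good bad : (ℕ → ℕ) → ℕ → ℕ → ℕ
  good F x y = ⟦ F (suc y) ≤? x ⟧
  bad  F x y = ⟦ x <? F (suc y) ⟧

  good+bad≡1 : ∀ F x y → good F x y + bad F x y ≡ 1
  good+bad≡1 F x y with F (suc y) ≤? x | x <? F (suc y)
  ... | yes p | yes q = ⊥-elim (<⇒≱ q p)
  ... | yes p | no  q = refl
  ... | no  p | yes q = refl
  ... | no  p | no  q = ⊥-elim (q (≰⇒> p))

  -- If `h` weighs the chains leading up to a point, this appends one more good point to them. So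
  -- `extendⁿ F r one x y` counts the chains of `r` good points strictly left of and below
  -- `(x , y)`.
  extend : (ℕ → ℕ) → (ℕ → ℕ → ℕ) → ℕ → ℕ → ℕ
  extend F h x y = ∑[ x′ < x ] ∑[ y′ < y ] (good F x′ y′ * h x′ y′)

  extendⁿ : (ℕ → ℕ) → ℕ → (ℕ → ℕ → ℕ) → ℕ → ℕ → ℕ
  extendⁿ F zero    h = h
  extendⁿ F (suc r) h = extendⁿ F r (extend F h)

  -- Both sides sum over the same pairs of comparable points, the lower one good. The lower point is
  -- grouped with what precedes it on the left and with what follows it on the right.
  adjoint : ∀ F k l h (w : ℕ → ℕ → ℕ) →
    ∑[ x < k ] ∑[ y < l ] (extend F h x y * w x y) ≡
    ∑[ x < k ] ∑[ y < l ] (good F x y * h x y * upper k l w (suc x) (suc y))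
  adjoint F k l h w = begin
    ∑[ x < k ] ∑[ y < l ] (extend F h x y * w x y)
      ≡⟨ ∑-cong k (λ x → ∑-cong l λ y → sym (trans (∑-cong x λ x′ → ∑-*ʳ y (w x y) _) (∑-*ʳ x (w x y) _))) ⟩
    ∑[ x < k ] ∑[ y < l ] ∑[ x′ < x ] ∑[ y′ < y ] (good F x′ y′ * h x′ y′ * w x y)
      ≡⟨ ∑∑-triangle k l (λ x′ y′ x y → good F x′ y′ * h x′ y′ * w x y) ⟩
    ∑[ x < k ] ∑[ y < l ] upper k l (λ x′ y′ → good F x y * h x y * w x′ y′) (suc x) (suc y)
      ≡⟨ ∑-cong k (λ x → ∑-cong l λ y → upper-*ˡ k l (good F x y * h x y) w (suc x) (suc y)) ⟩
    ∑[ x < k ] ∑[ y < l ] (good F x y * h x y * upper k l w (suc x) (suc y)) ∎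
    where open ≡-Reasoning

  -- The recursion chooses the first point of a chain, as suits a path read from the origin;
  -- `extendⁿ` chooses last points, as suits the search for the first bad one.
  goodChains : (ℕ → ℕ) → ℕ → ℕ → ℕ → ℕ → ℕ → ℕ
  goodChains F k l zero    a b = 1
  goodChains F k l (suc c) a b = upper k l (λ x y → good F x y * goodChains F k l c (suc x) (suc y)) a b

  -- Each use of `adjoint` moves the first point of the remaining chain into `h`, until none
  -- remains.
  ∑-goodChains : ∀ F k l r h →
    ∑[ x < k ] ∑[ y < l ] (h x y * (good F x y * goodChains F k l r (suc x) (suc y))) ≡ extendⁿ F (suc r) h k l
  ∑-goodChains F k l zero h = ∑-cong k λ x → ∑-cong l λ y → rearrange (h x y) (good F x y)
    where
    rearrange : ∀ p q → p * (q * 1) ≡ q * p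
    rearrange = solve-∀
  ∑-goodChains F k l (suc r) h = begin
    ∑[ x < k ] ∑[ y < l ] (h x y * (good F x y * goodChains F k l (suc r) (suc x) (suc y)))
      ≡⟨ ∑-cong k (λ x → ∑-cong l λ y → rearrange (h x y) (good F x y) _) ⟩
    ∑[ x < k ] ∑[ y < l ] (good F x y * h x y * goodChains F k l (suc r) (suc x) (suc y))
      ≡⟨ adjoint F k l h (λ x y → good F x y * goodChains F k l r (suc x) (suc y)) ⟨
    ∑[ x < k ] ∑[ y < l ] (extend F h x y * (good F x y * goodChains F k l r (suc x) (suc y)))
      ≡⟨ ∑-goodChains F k l r (extend F h) ⟩
    extendⁿ F (suc (suc r)) h k l ∎
    where
    open ≡-Reasoning
    rearrange : ∀ p q s → p * (q * s) ≡ q * p * s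
    rearrange = solve-∀

  one : ℕ → ℕ → ℕ
  one _ _ = 1

  goodChains≡extendⁿ : ∀ F k l r → goodChains F k l (suc r) 0 0 ≡ extendⁿ F (suc r) one k l
  goodChains≡extendⁿ F k l r = trans
    (∑-cong k λ x → trans (⟦⟧-true-* (0 ≤? x) z≤n _) (∑-cong l λ y →
      trans (⟦⟧-true-* (0 ≤? y) z≤n _) (sym (*-identityˡ _))))
    (∑-goodChains F k l r one)

  -- Arbitrary chains and their first bad point.

  chains : ℕ → ℕ → ℕ → ℕ → ℕ → ℕ
  chains k l r x y = ((k ∸ x) C r) * ((l ∸ y) C r)

  -- A chain is an independent choice of columns and of equally many rows, so the double sum factors
  -- into two hockey sticks.
  upper-chains : ∀ k l r a b → upper k l (λ x y → chains k l r (suc x) (suc y)) a b ≡ chains k l (suc r) a b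
  upper-chains k l r a b = begin
    ∑[ x < k ] (⟦ a ≤? x ⟧ * (∑[ y < l ] (⟦ b ≤? y ⟧ * chains k l r (suc x) (suc y))))
      ≡⟨ ∑-cong k (λ x → trans
           (cong (⟦ a ≤? x ⟧ *_) (trans
             (∑-cong l λ y → rearrange ⟦ b ≤? y ⟧ ((k ∸ suc x) C r) ((l ∸ suc y) C r))
             (trans (∑-*ˡ l ((k ∸ suc x) C r) _) (cong (((k ∸ suc x) C r) *_) (hockey-stick l b r)))))
           (sym (*-assoc ⟦ a ≤? x ⟧ _ _))) ⟩
    ∑[ x < k ] (⟦ a ≤? x ⟧ * ((k ∸ suc x) C r) * ((l ∸ b) C suc r))
      ≡⟨ ∑-*ʳ k ((l ∸ b) C suc r) _ ⟩
    (∑[ x < k ] (⟦ a ≤? x ⟧ * ((k ∸ suc x) C r))) * ((l ∸ b) C suc r)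
      ≡⟨ cong (_* ((l ∸ b) C suc r)) (hockey-stick k a r) ⟩
    chains k l (suc r) a b ∎
    where
    open ≡-Reasoning
    rearrange : ∀ p q s → p * (q * s) ≡ q * (p * s)
    rearrange = solve-∀

  -- convolve F u r h = Σ_{i ≤ r} extendⁱ h · u (r − i)
  convolve : (ℕ → ℕ) → (ℕ → ℕ) → ℕ → (ℕ → ℕ → ℕ) → ℕ → ℕ → ℕ
  convolve F u zero    h x y = h x y * u 0
  convolve F u (suc r) h x y = h x y * u (suc r) + convolve F u r (extend F h) x y

  -- The continuations of a first bad point: any `s` further points, good or bad.
  chainsTo : ℕ → ℕ → ℕ → ℕ → ℕ → ℕ
  chainsTo k l x y s = chains k l s (suc x) (suc y)

  -- Test the first of the `r + 1` points. If it is bad, the good points before it are already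
  -- recorded in `h`; if it is good, `adjoint` absorbs it into `h` and the induction goes on with
  -- one point fewer.
  first-bad : ∀ F k l r h →
    ∑[ x < k ] ∑[ y < l ] (h x y * chains k l r (suc x) (suc y)) ≡
    extendⁿ F (suc r) h k l + (∑[ x < k ] ∑[ y < l ] (bad F x y * convolve F (chainsTo k l x y) r h x y))
  first-bad F k l zero h = begin
    ∑[ x < k ] ∑[ y < l ] (h x y * chains k l 0 (suc x) (suc y))
      ≡⟨ ∑-cong k (λ x → ∑-cong l λ y → eq x y) ⟩
    ∑[ x < k ] ∑[ y < l ] (good F x y * h x y + bad F x y * (h x y * chains k l 0 (suc x) (suc y)))
      ≡⟨ ∑∑-+ k l _ _ ⟩
    extend F h k l + (∑[ x < k ] ∑[ y < l ] (bad F x y * convolve F (chainsTo k l x y) 0 h x y)) ∎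
    where
    open ≡-Reasoning
    rearrange : ∀ p q s → (p + q) * s ≡ p * s + q * (s * 1)
    rearrange = solve-∀
    chains0 : ∀ x y → chains k l 0 x y ≡ 1
    chains0 x y = cong₂ _*_ (nC0≡1 (k ∸ x)) (nC0≡1 (l ∸ y))
    eq : ∀ x y → h x y * chains k l 0 (suc x) (suc y) ≡
      good F x y * h x y + bad F x y * (h x y * chains k l 0 (suc x) (suc y))
    eq x y rewrite chains0 (suc x) (suc y) = begin
      h x y * 1                              ≡⟨ *-comm (h x y) 1 ⟩
      1 * h x y                              ≡⟨ cong (_* h x y) (good+bad≡1 F x y) ⟨
      (good F x y + bad F x y) * h x y       ≡⟨ rearrange (good F x y) (bad F x y) (h x y) ⟩
      good F x y * h x y + bad F x y * (h x y * 1) ∎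
  first-bad F k l (suc r) h = begin
    ∑[ x < k ] ∑[ y < l ] (h x y * w x y)
      ≡⟨ ∑-cong k (λ x → ∑-cong l λ y → eq x y) ⟩
    ∑[ x < k ] ∑[ y < l ] (good F x y * h x y * w x y + bad F x y * (h x y * w x y))
      ≡⟨ ∑∑-+ k l _ _ ⟩
    (∑[ x < k ] ∑[ y < l ] (good F x y * h x y * w x y)) + B₀
      ≡⟨ cong (_+ B₀) (∑-cong k λ x → ∑-cong l λ y →
           cong (good F x y * h x y *_) (sym (upper-chains k l r (suc x) (suc y)))) ⟩
    (∑[ x < k ] ∑[ y < l ] (good F x y * h x y * upper k l (λ x y → chains k l r (suc x) (suc y)) (suc x) (suc y))) + B₀
      ≡⟨ cong (_+ B₀) (adjoint F k l h (λ x y → chains k l r (suc x) (suc y))) ⟨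
    (∑[ x < k ] ∑[ y < l ] (extend F h x y * chains k l r (suc x) (suc y))) + B₀
      ≡⟨ cong (_+ B₀) (first-bad F k l r (extend F h)) ⟩
    D + B₁ + B₀
      ≡⟨ trans (+-assoc D B₁ B₀) (cong (D +_) (+-comm B₁ B₀)) ⟩
    D + (B₀ + B₁)
      ≡⟨ cong (D +_) (trans (sym (∑∑-+ k l _ _)) (∑-cong k λ x → ∑-cong l λ y → sym (*-distribˡ-+ (bad F x y) _ _))) ⟩
    D + (∑[ x < k ] ∑[ y < l ] (bad F x y * convolve F (chainsTo k l x y) (suc r) h x y)) ∎
    where
    open ≡-Reasoning
    w : ℕ → ℕ → ℕ
    w x y = chains k l (suc r) (suc x) (suc y)
    D B₀ B₁ : ℕ
    D  = extendⁿ F (suc r) (extend F h) k l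
    B₀ = ∑[ x < k ] ∑[ y < l ] (bad F x y * (h x y * w x y))
    B₁ = ∑[ x < k ] ∑[ y < l ] (bad F x y * convolve F (chainsTo k l x y) r (extend F h) x y)
    rearrange : ∀ p q s t → (p + q) * (s * t) ≡ p * s * t + q * (s * t)
    rearrange = solve-∀
    eq : ∀ x y → h x y * w x y ≡ good F x y * h x y * w x y + bad F x y * (h x y * w x y)
    eq x y = begin
      h x y * w x y                              ≡⟨ *-identityˡ _ ⟨
      1 * (h x y * w x y)                        ≡⟨ cong (_* (h x y * w x y)) (good+bad≡1 F x y) ⟨
      (good F x y + bad F x y) * (h x y * w x y) ≡⟨ rearrange (good F x y) (bad F x y) (h x y) (w x y) ⟩
      good F x y * h x y * w x y + bad F x y * (h x y * w x y) ∎

  extend-+ : ∀ F h h′ x y → extend F (λ x y → h x y + h′ x y) x y ≡ extend F h x y + extend F h′ x y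
  extend-+ F h h′ x y = trans
    (∑-cong x λ x′ → ∑-cong y λ y′ → *-distribˡ-+ (good F x′ y′) _ _)
    (∑∑-+ x y _ _)

  extend-*ʳ : ∀ F h c x y → extend F (λ x y → h x y * c) x y ≡ extend F h x y * c
  extend-*ʳ F h c x y = trans
    (∑-cong x λ x′ → trans
      (∑-cong y λ y′ → sym (*-assoc (good F x′ y′) _ c))
      (∑-*ʳ y c _))
    (∑-*ʳ x c _)

  extend-convolve : ∀ F u r h x y → extend F (convolve F u r h) x y ≡ convolve F u r (extend F h) x y
  extend-convolve F u zero    h x y = extend-*ʳ F h (u 0) x y
  extend-convolve F u (suc r) h x y = trans
    (extend-+ F _ (convolve F u r (extend F h)) x y)
    (cong₂ _+_ (extend-*ʳ F h (u (suc r)) x y) (extend-convolve F u r (extend F h) x y))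

  -- The definition peels off good points at the start of the chain; this form peels off the one
  -- nearest to `(x , y)`, which is the one needed for locality and for reading backwards.
  convolve-suc : ∀ F u r h x y →
    convolve F u (suc r) h x y ≡ h x y * u (suc r) + extend F (convolve F u r h) x y
  convolve-suc F u r h x y = cong (h x y * u (suc r) +_) (sym (extend-convolve F u r h x y))

  convolve-cong : ∀ F {u v : ℕ → ℕ} → (∀ s → u s ≡ v s) → ∀ r h x y → convolve F u r h x y ≡ convolve F v r h x y
  convolve-cong F e zero    h x y = cong (h x y *_) (e 0)
  convolve-cong F e (suc r) h x y = cong₂ _+_ (cong (h x y *_) (e (suc r))) (convolve-cong F e r _ x y)

  convolve-∑ : ∀ F n (c : ℕ → ℕ) (u : ℕ → ℕ → ℕ) r h x y →
    ∑[ i < n ] (c i * convolve F (u i) r h x y) ≡ convolve F (λ s → ∑[ i < n ] (c i * u i s)) r h x y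
  convolve-∑ F n c u zero h x y = trans
    (∑-cong n λ i → rearrange (c i) (h x y) (u i 0))
    (∑-*ˡ n (h x y) _)
    where
    rearrange : ∀ p q s → p * (q * s) ≡ q * (p * s)
    rearrange = solve-∀
  convolve-∑ F n c u (suc r) h x y = trans
    (∑-cong n λ i → rearrange (c i) (h x y) (u i (suc r)) _)
    (trans (∑-+ n _ _) (cong₂ _+_ (∑-*ˡ n (h x y) _) (convolve-∑ F n c u r (extend F h) x y)))
    where
    rearrange : ∀ p q s t → p * (q * s + t) ≡ q * (p * s) + p * t
    rearrange = solve-∀

  -- Bad points and the parts of the composition.

  Monotone : (ℕ → ℕ) → Set
  Monotone F = ∀ {x y} → x ≤ y → F x ≤ F y

  -- Points below row y and left of x < F (q + 1) can only be good below row q.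
  extend-local : ∀ {F} → Monotone F → ∀ h {x y q} → q ≤ y → x < F (suc q) → extend F h x y ≡ extend F h x q
  extend-local {F} mono h {x} {y} {q} q≤y x<F = ∑-cong< x λ x′ x′<x → begin
    ∑[ y′ < y ] (good F x′ y′ * h x′ y′)
      ≡⟨ ∑-cong y (λ y′ → restrict x′ x′<x y′) ⟩
    ∑[ y′ < y ] (⟦ y′ <? q ⟧ * (good F x′ y′ * h x′ y′))
      ≡⟨ ∑-below q≤y _ ⟩
    ∑[ y′ < q ] (good F x′ y′ * h x′ y′) ∎
    where
    open ≡-Reasoning
    restrict : ∀ x′ → x′ < x → ∀ y′ → good F x′ y′ * h x′ y′ ≡ ⟦ y′ <? q ⟧ * (good F x′ y′ * h x′ y′)
    restrict x′ x′<x y′ with y′ <? q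
    ... | yes _    = sym (*-identityˡ _)
    ... | no y′≮q = ⟦⟧-false-* (F (suc y′) ≤? x′)
      (<⇒≱ (<-trans x′<x (<-≤-trans x<F (mono (s≤s (≮⇒≥ y′≮q)))))) (h x′ y′)

  convolve-local : ∀ {F} → Monotone F → ∀ u r {x y q} → q ≤ y → x < F (suc q) →
    convolve F u r one x y ≡ convolve F u r one x q
  convolve-local mono u zero    q≤y x<F = refl
  convolve-local {F} mono u (suc r) {x} {y} {q} q≤y x<F = begin
    convolve F u (suc r) one x y                       ≡⟨ convolve-suc F u r one x y ⟩
    1 * u (suc r) + extend F (convolve F u r one) x y  ≡⟨ cong (1 * u (suc r) +_) (extend-local mono _ q≤y x<F) ⟩
    1 * u (suc r) + extend F (convolve F u r one) x q  ≡⟨ convolve-suc F u r one x q ⟨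
    convolve F u (suc r) one x q ∎
    where open ≡-Reasoning

  inPart : (ℕ → ℕ) → ℕ → ℕ → ℕ
  inPart F q x = ⟦ F q ≤? x ⟧ * ⟦ x <? F (suc q) ⟧

  -- The parts in the rows below `y` tile the abscissas from 0 up to `F y`.
  ∑-inPart : ∀ {F} → F 0 ≡ 0 → Monotone F → ∀ x y → ∑[ q < y ] inPart F q x ≡ ⟦ x <? F y ⟧
  ∑-inPart {F} F0 mono x zero    = sym (⟦⟧-false (x <? F 0) (subst (λ v → ¬ x < v) (sym F0) λ ()))
  ∑-inPart {F} F0 mono x (suc y) = begin
    ∑[ q < suc y ] inPart F q x                      ≡⟨ ∑-last y _ ⟩
    (∑[ q < y ] inPart F q x) + inPart F y x         ≡⟨ cong (_+ inPart F y x) (∑-inPart F0 mono x y) ⟩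
    ⟦ x <? F y ⟧ + inPart F y x                      ≡⟨ last ⟩
    ⟦ x <? F (suc y) ⟧ ∎
    where
    open ≡-Reasoning
    last : ⟦ x <? F y ⟧ + inPart F y x ≡ ⟦ x <? F (suc y) ⟧
    last with F y ≤? x
    ... | yes Fy≤x = trans (cong (_+ 1 * ⟦ x <? F (suc y) ⟧) (⟦⟧-false (x <? F y) (≤⇒≯ Fy≤x))) (*-identityˡ _)
    ... | no  Fy≰x = trans (cong (_+ 0) (⟦⟧-true (x <? F y) (≰⇒> Fy≰x)))
                       (sym (⟦⟧-true (x <? F (suc y)) (<-≤-trans (≰⇒> Fy≰x) (mono (n≤1+n y)))))

  bad≡∑-inPart : ∀ {F} → F 0 ≡ 0 → Monotone F → ∀ x {y l} → y < l →
    bad F x y ≡ ∑[ q < l ] (⟦ q ≤? y ⟧ * inPart F q x)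
  bad≡∑-inPart {F} F0 mono x {y} {l} y<l = begin
    bad F x y                                        ≡⟨ ∑-inPart F0 mono x (suc y) ⟨
    ∑[ q < suc y ] inPart F q x                      ≡⟨ ∑-below y<l _ ⟨
    ∑[ q < l ] (⟦ q <? suc y ⟧ * inPart F q x)       ≡⟨ ∑-cong l (λ q → cong (_* inPart F q x)
                                                          (⟦⟧-⇔ (q <? suc y) (q ≤? y) ≤-pred s≤s)) ⟩
    ∑[ q < l ] (⟦ q ≤? y ⟧ * inPart F q x) ∎
    where open ≡-Reasoning

  ∑-part : ∀ F {k} q b (h : ℕ → ℕ) → F (suc q) ≡ F q + b → F (suc q) ≤ k →
    ∑[ x < k ] (inPart F q x * h x) ≡ ∑[ o < b ] h (F q + o)
  ∑-part F {k} q b h eq ≤k = begin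
    ∑[ x < k ] (inPart F q x * h x)
      ≡⟨ ∑-cong k (λ x → rearrange ⟦ F q ≤? x ⟧ ⟦ x <? F (suc q) ⟧ (h x)) ⟩
    ∑[ x < k ] (⟦ x <? F (suc q) ⟧ * (⟦ F q ≤? x ⟧ * h x))
      ≡⟨ ∑-below ≤k _ ⟩
    ∑[ x < F (suc q) ] (⟦ F q ≤? x ⟧ * h x)
      ≡⟨ cong (λ v → ∑[ x < v ] (⟦ F q ≤? x ⟧ * h x)) eq ⟩
    ∑[ x < F q + b ] (⟦ F q ≤? x ⟧ * h x)
      ≡⟨ ∑-from (F q) b h ⟩
    ∑[ o < b ] h (F q + o) ∎
    where
    open ≡-Reasoning
    rearrange : ∀ p q s → p * q * s ≡ q * (p * s)
    rearrange = solve-∀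

  -- The continuations after summing out the bad row `y`: it becomes the least of `suc s` rows
  -- chosen from `q` on, while the `s` columns stay to the right of `x`.
  weight : ℕ → ℕ → ℕ → ℕ → ℕ → ℕ
  weight k l x q s = ((k ∸ suc x) C s) * ((l ∸ q) C suc s)

  ∑-chainsTo : ∀ k l x q s → ∑[ y < l ] (⟦ q ≤? y ⟧ * chainsTo k l x y s) ≡ weight k l x q s
  ∑-chainsTo k l x q s = begin
    ∑[ y < l ] (⟦ q ≤? y ⟧ * chainsTo k l x y s)
      ≡⟨ ∑-cong l (λ y → rearrange ⟦ q ≤? y ⟧ ((k ∸ suc x) C s) ((l ∸ suc y) C s)) ⟩
    ∑[ y < l ] (((k ∸ suc x) C s) * (⟦ q ≤? y ⟧ * ((l ∸ suc y) C s)))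
      ≡⟨ ∑-*ˡ l ((k ∸ suc x) C s) _ ⟩
    ((k ∸ suc x) C s) * (∑[ y < l ] (⟦ q ≤? y ⟧ * ((l ∸ suc y) C s)))
      ≡⟨ cong (((k ∸ suc x) C s) *_) (hockey-stick l q s) ⟩
    weight k l x q s ∎
    where
    open ≡-Reasoning
    rearrange : ∀ p q s → p * (q * s) ≡ q * (p * s)
    rearrange = solve-∀

  -- A bad point (x , y) lies in a part q ≤ y of the boundary, and the good chains
  -- leading to it are those leading to (x , q), so y can be summed out.
  bad-by-part : ∀ {F} → F 0 ≡ 0 → Monotone F → ∀ k l r x →
    ∑[ y < l ] (bad F x y * convolve F (chainsTo k l x y) r one x y) ≡
    ∑[ q < l ] (inPart F q x * convolve F (weight k l x q) r one x q)
  bad-by-part {F} F0 mono k l r x = begin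
    ∑[ y < l ] (bad F x y * T y y)
      ≡⟨ ∑-cong< l (λ y y<l → trans
           (cong (_* T y y) (bad≡∑-inPart F0 mono x y<l))
           (sym (∑-*ʳ l (T y y) _))) ⟩
    ∑[ y < l ] ∑[ q < l ] (⟦ q ≤? y ⟧ * inPart F q x * T y y)
      ≡⟨ ∑-cong l (λ y → ∑-cong l λ q → local q y) ⟩
    ∑[ y < l ] ∑[ q < l ] (inPart F q x * (⟦ q ≤? y ⟧ * T y q))
      ≡⟨ ∑-swap l l _ ⟩
    ∑[ q < l ] ∑[ y < l ] (inPart F q x * (⟦ q ≤? y ⟧ * T y q))
      ≡⟨ ∑-cong l (λ q → trans
           (∑-*ˡ l (inPart F q x) _)
           (cong (inPart F q x *_) (trans
             (convolve-∑ F l (λ y → ⟦ q ≤? y ⟧) (λ y → chainsTo k l x y) r one x q)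
             (convolve-cong F (∑-chainsTo k l x q) r one x q)))) ⟩
    ∑[ q < l ] (inPart F q x * convolve F (weight k l x q) r one x q) ∎
    where
    open ≡-Reasoning
    T : ℕ → ℕ → ℕ
    T y z = convolve F (chainsTo k l x y) r one x z
    rearrange : ∀ a b c d → a * (b * c) * d ≡ b * c * (a * d)
    rearrange = solve-∀
    local : ∀ q y → ⟦ q ≤? y ⟧ * inPart F q x * T y y ≡ inPart F q x * (⟦ q ≤? y ⟧ * T y q)
    local q y with q ≤? y | x <? F (suc q)
    ... | yes q≤y | yes x<F = trans (rearrange 1 ⟦ F q ≤? x ⟧ 1 (T y y))
            (cong (λ v → ⟦ F q ≤? x ⟧ * 1 * (1 * v)) (convolve-local mono _ r q≤y x<F))
    ... | yes q≤y | no _  rewrite *-zeroʳ ⟦ F q ≤? x ⟧ = refl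
    ... | no _    | _     = sym (*-zeroʳ (⟦ F q ≤? x ⟧ * _))

  -- `F l ≤ k` keeps all parts in rows below `l` inside the box, so an abscissa can be replaced by a
  -- unit, given by its row `q` and its offset `o` in the part.
  bad-by-unit : ∀ {F} → F 0 ≡ 0 → Monotone F → ∀ k l r (b : ℕ → ℕ) →
    (∀ q → F (suc q) ≡ F q + b q) → F l ≤ k →
    ∑[ x < k ] ∑[ y < l ] (bad F x y * convolve F (chainsTo k l x y) r one x y) ≡
    ∑[ q < l ] ∑[ o < b q ] convolve F (weight k l (F q + o) q) r one (F q + o) q
  bad-by-unit {F} F0 mono k l r b step Fl≤k = begin
    ∑[ x < k ] ∑[ y < l ] (bad F x y * convolve F (chainsTo k l x y) r one x y)
      ≡⟨ ∑-cong k (bad-by-part F0 mono k l r) ⟩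
    ∑[ x < k ] ∑[ q < l ] (inPart F q x * convolve F (weight k l x q) r one x q)
      ≡⟨ ∑-swap k l _ ⟩
    ∑[ q < l ] ∑[ x < k ] (inPart F q x * convolve F (weight k l x q) r one x q)
      ≡⟨ ∑-cong< l (λ q q<l → ∑-part F q (b q) _ (step q) (≤-trans (mono q<l) Fl≤k)) ⟩
    ∑[ q < l ] ∑[ o < b q ] convolve F (weight k l (F q + o) q) r one (F q + o) q ∎
    where open ≡-Reasoning

  -- Reading chains backwards

  -- Good chains leading to (g q , q), read backwards in coordinates relative to that point.
  backward : (ℕ → ℕ) → ℕ → (ℕ → ℕ) → ℕ → ℕ → ℕ → ℕ
  backward g q u zero    a b = u 0
  backward g q u (suc r) a b =
    u (suc r) + (∑[ y < q ] (⟦ b ≤? y ⟧ * (∑[ x < g y ] (⟦ a ≤? x ⟧ * backward g q u r (suc x) (suc y)))))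

  backward-cong : ∀ {g g′ : ℕ → ℕ} q {u u′ : ℕ → ℕ} → (∀ y → g y ≡ g′ y) → (∀ s → u s ≡ u′ s) →
    ∀ r a b → backward g q u r a b ≡ backward g′ q u′ r a b
  backward-cong q eg eu zero    a b = eu 0
  backward-cong {g} {g′} q eg eu (suc r) a b = cong₂ _+_ (eu (suc r)) (∑-cong q λ y → cong (⟦ b ≤? y ⟧ *_) (trans
    (cong (λ n → ∑ n _) (eg y))
    (∑-cong (g′ y) λ x → cong (⟦ a ≤? x ⟧ *_) (backward-cong q eg eu r (suc x) (suc y)))))

  -- Half a turn about `(g q , q)`. The hypothesis says that `g` is the boundary `F` seen after this
  -- turn; a point is good exactly if its image satisfies `x < g y`.
  convolve≡backward : ∀ F g q → (∀ y → y ≤ q → F (q ∸ y) + g y ≡ g q) → ∀ u r a b →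
    convolve F u r one (g q ∸ a) (q ∸ b) ≡ backward g q u r a b
  convolve≡backward F g q e u zero    a b = *-identityˡ (u 0)
  convolve≡backward F g q e u (suc r) a b = begin
    convolve F u (suc r) one (g q ∸ a) (q ∸ b)
      ≡⟨ convolve-suc F u r one (g q ∸ a) (q ∸ b) ⟩
    1 * u (suc r) + (∑[ x < g q ∸ a ] ∑[ y < q ∸ b ] (good F x y * T x y))
      ≡⟨ cong₂ _+_ (*-identityˡ (u (suc r))) flip ⟩
    backward g q u (suc r) a b ∎
    where
    open ≡-Reasoning
    T : ℕ → ℕ → ℕ
    T = convolve F u r one
    B : ℕ → ℕ → ℕ
    B x y = backward g q u r (suc x) (suc y)
    rearrange : ∀ p q s t → p * (q * (s * t)) ≡ q * (s * (p * t))
    rearrange = solve-∀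
    good≡ : ∀ x y → x < g q → y < q → good F (g q ∸ suc x) (q ∸ suc y) ≡ ⟦ x <? g y ⟧
    -- `good` looks at the boundary one row higher, and the row after `q ∸ suc y` is `q ∸ y`.
    good≡ x y x<gq y<q rewrite sym (+-∸-assoc 1 y<q) = ⟦⟧-⇔ (F (q ∸ y) ≤? g q ∸ suc x) (x <? g y)
      (λ le → +-cancelˡ-≤ (F (q ∸ y)) _ _ (begin′ le))
      (λ lt → m+n≤o⇒m≤o∸n (F (q ∸ y)) (≤-trans (+-monoʳ-≤ (F (q ∸ y)) lt) (≤-reflexive e′)))
      where
      e′ : F (q ∸ y) + g y ≡ g q
      e′ = e y (<⇒≤ y<q)
      begin′ : F (q ∸ y) ≤ g q ∸ suc x → F (q ∸ y) + suc x ≤ F (q ∸ y) + g y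
      begin′ le = ≤-trans (m≤o∸n⇒m+n≤o (F (q ∸ y)) x<gq le) (≤-reflexive (sym e′))
    g≤gq : ∀ y → y < q → g y ≤ g q
    g≤gq y y<q = ≤-trans (m≤n+m (g y) (F (q ∸ y))) (≤-reflexive (e y (<⇒≤ y<q)))
    flip : ∑[ x < g q ∸ a ] ∑[ y < q ∸ b ] (good F x y * T x y) ≡
           ∑[ y < q ] (⟦ b ≤? y ⟧ * (∑[ x < g y ] (⟦ a ≤? x ⟧ * B x y)))
    flip = begin
      ∑[ x < g q ∸ a ] ∑[ y < q ∸ b ] (good F x y * T x y)
        ≡⟨ ∑-flip (g q) a _ ⟩
      ∑[ x < g q ] (⟦ a ≤? x ⟧ * (∑[ y < q ∸ b ] (good F (g q ∸ suc x) y * T (g q ∸ suc x) y)))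
        ≡⟨ ∑-cong (g q) (λ x → trans
             (cong (⟦ a ≤? x ⟧ *_) (∑-flip q b _))
             (sym (∑-*ˡ q ⟦ a ≤? x ⟧ _))) ⟩
      ∑[ x < g q ] ∑[ y < q ] (⟦ a ≤? x ⟧ * (⟦ b ≤? y ⟧ *
        (good F (g q ∸ suc x) (q ∸ suc y) * T (g q ∸ suc x) (q ∸ suc y))))
        ≡⟨ ∑-cong< (g q) (λ x x<gq → ∑-cong< q λ y y<q → trans
             (cong₂ (λ v w → ⟦ a ≤? x ⟧ * (⟦ b ≤? y ⟧ * (v * w))) (good≡ x y x<gq y<q)
               (convolve≡backward F g q e u r (suc x) (suc y)))
             (rearrange ⟦ a ≤? x ⟧ ⟦ b ≤? y ⟧ ⟦ x <? g y ⟧ (B x y))) ⟩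
      ∑[ x < g q ] ∑[ y < q ] (⟦ b ≤? y ⟧ * (⟦ x <? g y ⟧ * (⟦ a ≤? x ⟧ * B x y)))
        ≡⟨ ∑-swap (g q) q _ ⟩
      ∑[ y < q ] ∑[ x < g q ] (⟦ b ≤? y ⟧ * (⟦ x <? g y ⟧ * (⟦ a ≤? x ⟧ * B x y)))
        ≡⟨ ∑-cong< q (λ y y<q → trans
             (∑-*ˡ (g q) ⟦ b ≤? y ⟧ _)
             (cong (⟦ b ≤? y ⟧ *_) (∑-below (g≤gq y y<q) _))) ⟩
      ∑[ y < q ] (⟦ b ≤? y ⟧ * (∑[ x < g y ] (⟦ a ≤? x ⟧ * B x y))) ∎

  -- A pair of chains, of r column values above a and r + 2 row values above b, is split
  -- at the first column value that exceeds g at the matching row.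
  ∑-backward : ∀ {g} K l → Monotone g → (∀ q → q < l → g q ≤ K) → ∀ r a b → a ≤ g b →
    ∑[ q < l ] (⟦ b ≤? q ⟧ * backward g q (weight (suc K) l (g q) q) r a b) ≡
    ((K ∸ a) C r) * ((suc l ∸ b) C suc (suc r))
  ∑-backward {g} K l mono g≤K zero a b a≤gb = begin
    -- With no columns to choose, `q` is the lower of the two chosen rows; the other is one of the
    -- `l ∸ q` rows above it, counted after the raising by one.
    ∑[ q < l ] (⟦ b ≤? q ⟧ * (((K ∸ g q) C 0) * ((l ∸ q) C 1)))
      ≡⟨ ∑-cong l (λ q → cong (⟦ b ≤? q ⟧ *_) (trans (cong (_* ((l ∸ q) C 1)) (nC0≡1 (K ∸ g q))) (*-identityˡ _))) ⟩
    ∑[ q < l ] (⟦ b ≤? q ⟧ * ((l ∸ q) C 1))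
      ≡⟨ hockey-stick′ l b 0 ⟩
    (suc l ∸ b) C 2
      ≡⟨ trans (cong (_* ((suc l ∸ b) C 2)) (nC0≡1 (K ∸ a))) (*-identityˡ _) ⟨
    ((K ∸ a) C 0) * ((suc l ∸ b) C 2) ∎
    where open ≡-Reasoning
  ∑-backward {g} K l mono g≤K (suc r) a b a≤gb = begin
    -- Either the backward chain stops, or its next point lies in some row `y < q`.
    ∑[ q < l ] (⟦ b ≤? q ⟧ * (w q + (∑[ y < q ] (⟦ b ≤? y ⟧ * Z q y))))
      ≡⟨ trans (∑-cong l λ q → *-distribˡ-+ ⟦ b ≤? q ⟧ (w q) _) (∑-+ l _ _) ⟩
    S + (∑[ q < l ] (⟦ b ≤? q ⟧ * (∑[ y < q ] (⟦ b ≤? y ⟧ * Z q y))))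
      ≡⟨ cong (S +_) (∑-cong l λ q → trans (sym (∑-*ˡ q ⟦ b ≤? q ⟧ _)) (∑-cong< q λ y y<q → redundant q y y<q)) ⟩
    S + (∑[ q < l ] ∑[ y < q ] (⟦ b ≤? y ⟧ * Z q y))
      ≡⟨ cong (S +_) (∑-triangle l (λ y q → ⟦ b ≤? y ⟧ * Z q y)) ⟩
    S + (∑[ y < l ] ∑[ q < l ] (⟦ suc y ≤? q ⟧ * (⟦ b ≤? y ⟧ * Z q y)))
      ≡⟨ cong (S +_) (∑-cong l inner) ⟩
    S + (∑[ y < l ] (⟦ b ≤? y ⟧ * (X y * ((l ∸ y) C suc (suc r)))))
      ≡⟨ ∑-+ l _ _ ⟨
    ∑[ y < l ] (⟦ b ≤? y ⟧ * w y + ⟦ b ≤? y ⟧ * (X y * ((l ∸ y) C suc (suc r))))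
      -- In both sums `y` is now the least chosen row. Either all columns are at least `g y`, or the
      -- least one is below it; together these are all choices of columns from `a` on, and `g`
      -- disappears.
      ≡⟨ ∑-cong< l partial ⟩
    ∑[ y < l ] (((K ∸ a) C suc r) * (⟦ b ≤? y ⟧ * ((l ∸ y) C suc (suc r))))
      ≡⟨ ∑-*ˡ l ((K ∸ a) C suc r) _ ⟩
    ((K ∸ a) C suc r) * (∑[ y < l ] (⟦ b ≤? y ⟧ * ((l ∸ y) C suc (suc r))))
      ≡⟨ cong (((K ∸ a) C suc r) *_) (hockey-stick′ l b (suc r)) ⟩
    ((K ∸ a) C suc r) * ((suc l ∸ b) C suc (suc (suc r))) ∎
    where
    open ≡-Reasoning
    w : ℕ → ℕ
    w q = weight (suc K) l (g q) q (suc r)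
    S : ℕ
    S = ∑[ q < l ] (⟦ b ≤? q ⟧ * w q)
    B : ℕ → ℕ → ℕ → ℕ
    B q x y = backward g q (weight (suc K) l (g q) q) r (suc x) (suc y)
    Z : ℕ → ℕ → ℕ
    Z q y = ∑[ x < g y ] (⟦ a ≤? x ⟧ * B q x y)
    X : ℕ → ℕ
    X y = ∑[ x < g y ] (⟦ a ≤? x ⟧ * ((K ∸ suc x) C r))
    redundant : ∀ q y → y < q → ⟦ b ≤? q ⟧ * (⟦ b ≤? y ⟧ * Z q y) ≡ ⟦ b ≤? y ⟧ * Z q y
    redundant q y y<q with b ≤? y
    ... | yes b≤y = ⟦⟧-true-* (b ≤? q) (≤-trans b≤y (<⇒≤ y<q)) _
    ... | no _    = *-zeroʳ ⟦ b ≤? q ⟧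
    rearrange₃ : ∀ p q s → p * (q * s) ≡ q * (p * s)
    rearrange₃ = solve-∀
    inner : ∀ y → ∑[ q < l ] (⟦ suc y ≤? q ⟧ * (⟦ b ≤? y ⟧ * Z q y)) ≡ ⟦ b ≤? y ⟧ * (X y * ((l ∸ y) C suc (suc r)))
    inner y = begin
      ∑[ q < l ] (⟦ suc y ≤? q ⟧ * (⟦ b ≤? y ⟧ * Z q y))
        ≡⟨ trans (∑-cong l λ q → rearrange₃ ⟦ suc y ≤? q ⟧ ⟦ b ≤? y ⟧ (Z q y)) (∑-*ˡ l ⟦ b ≤? y ⟧ _) ⟩
      ⟦ b ≤? y ⟧ * (∑[ q < l ] (⟦ suc y ≤? q ⟧ * Z q y))
        ≡⟨ cong (⟦ b ≤? y ⟧ *_) (trans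
             (∑-cong l λ q → trans (sym (∑-*ˡ (g y) ⟦ suc y ≤? q ⟧ _))
               (∑-cong (g y) λ x → rearrange₃ ⟦ suc y ≤? q ⟧ ⟦ a ≤? x ⟧ (B q x y)))
             (∑-swap l (g y) _)) ⟩
      ⟦ b ≤? y ⟧ * (∑[ x < g y ] ∑[ q < l ] (⟦ a ≤? x ⟧ * (⟦ suc y ≤? q ⟧ * B q x y)))
        ≡⟨ cong (⟦ b ≤? y ⟧ *_) (∑-cong< (g y) λ x x<gy → trans
             (∑-*ˡ l ⟦ a ≤? x ⟧ _)
             (trans (cong (⟦ a ≤? x ⟧ *_)
               (∑-backward K l mono g≤K r (suc x) (suc y) (≤-trans x<gy (mono (n≤1+n y)))))
               (sym (*-assoc ⟦ a ≤? x ⟧ _ _)))) ⟩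
      ⟦ b ≤? y ⟧ * (∑[ x < g y ] (⟦ a ≤? x ⟧ * ((K ∸ suc x) C r) * ((l ∸ y) C suc (suc r))))
        ≡⟨ cong (⟦ b ≤? y ⟧ *_) (∑-*ʳ (g y) ((l ∸ y) C suc (suc r)) _) ⟩
      ⟦ b ≤? y ⟧ * (X y * ((l ∸ y) C suc (suc r))) ∎
    rearrange : ∀ p q s t → p * (q * t) + p * (s * t) ≡ p * ((s + q) * t)
    rearrange = solve-∀
    partial : ∀ y → y < l → ⟦ b ≤? y ⟧ * w y + ⟦ b ≤? y ⟧ * (X y * ((l ∸ y) C suc (suc r))) ≡
      ((K ∸ a) C suc r) * (⟦ b ≤? y ⟧ * ((l ∸ y) C suc (suc r)))
    partial y y<l = begin
      ⟦ b ≤? y ⟧ * w y + ⟦ b ≤? y ⟧ * (X y * ((l ∸ y) C suc (suc r)))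
        ≡⟨ rearrange ⟦ b ≤? y ⟧ ((K ∸ g y) C suc r) (X y) _ ⟩
      ⟦ b ≤? y ⟧ * ((X y + (K ∸ g y) C suc r) * ((l ∸ y) C suc (suc r)))
        ≡⟨ ⟦⟧-cong-* (b ≤? y) (λ b≤y → cong (_* ((l ∸ y) C suc (suc r)))
             (hockey-stick-partial r (≤-trans a≤gb (mono b≤y)) (g≤K y y<l))) ⟩
      ⟦ b ≤? y ⟧ * (((K ∸ a) C suc r) * ((l ∸ y) C suc (suc r)))
        ≡⟨ rearrange₃ ⟦ b ≤? y ⟧ ((K ∸ a) C suc r) _ ⟩
      ((K ∸ a) C suc r) * (⟦ b ≤? y ⟧ * ((l ∸ y) C suc (suc r))) ∎

  -- Cyclic shifts

  Periodic : ℕ → (ℕ → ℕ) → Set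
  Periodic m α = ∀ x → α (x + m) ≡ α x

  periodic-* : ∀ {m α} → Periodic m α → ∀ n x → α (x + n * m) ≡ α x
  periodic-* {m} {α} per zero    x = cong α (+-identityʳ x)
  periodic-* {m} {α} per (suc n) x = begin
    α (x + (m + n * m))    ≡⟨ cong α (rearrange x m (n * m)) ⟩
    α ((x + n * m) + m)    ≡⟨ per (x + n * m) ⟩
    α (x + n * m)          ≡⟨ periodic-* per n x ⟩
    α x ∎
    where
    open ≡-Reasoning
    rearrange : ∀ x y z → x + (y + z) ≡ x + z + y
    rearrange = solve-∀

  -- Moving the start by one trades `α s` for the equal value `α (s + m)`.
  ∑-periodic : ∀ {m α} → Periodic m α → ∀ s → ∑[ i < m ] α (s + i) ≡ ∑ m α
  ∑-periodic         per zero    = refl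
  ∑-periodic {m} {α} per (suc s) = begin
    ∑[ i < m ] α (suc s + i)     ≡⟨ ∑-cong m (λ i → cong α (sym (+-suc s i))) ⟩
    ∑[ i < m ] α (s + suc i)     ≡⟨ +-cancelˡ-≡ (α s) _ _ total ⟩
    ∑[ i < m ] α (s + i)         ≡⟨ ∑-periodic per s ⟩
    ∑ m α ∎
    where
    open ≡-Reasoning
    total : α s + (∑[ i < m ] α (s + suc i)) ≡ α s + (∑[ i < m ] α (s + i))
    total = begin
      α s + (∑[ i < m ] α (s + suc i))         ≡⟨ cong (λ v → α v + (∑[ i < m ] α (s + suc i))) (+-identityʳ s) ⟨
      ∑[ i < suc m ] α (s + i)                 ≡⟨ ∑-last m _ ⟩
      (∑[ i < m ] α (s + i)) + α (s + m)       ≡⟨ +-comm _ (α (s + m)) ⟩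
      α (s + m) + (∑[ i < m ] α (s + i))       ≡⟨ cong (_+ (∑[ i < m ] α (s + i))) (per s) ⟩
      α s + (∑[ i < m ] α (s + i)) ∎

  -- The shift by `j` starts at index `m ∸ j`, so summing over shifts runs through a period
  -- downwards.
  ∑-periodic-reverse : ∀ {m α} → Periodic m α → ∀ s → ∑[ j < m ] α (s + (m ∸ j)) ≡ ∑ m α
  ∑-periodic-reverse {m} {α} per s = begin
    ∑[ j < m ] α (s + (m ∸ j))               ≡⟨ ∑-reverse m _ ⟩
    ∑[ j < m ] α (s + (m ∸ (m ∸ suc j)))     ≡⟨ ∑-cong< m (λ j j<m → cong α
                                                  (trans (cong (s +_) (m∸[m∸n]≡n j<m)) (+-suc s j))) ⟩
    ∑[ j < m ] α (suc s + j)                 ≡⟨ ∑-periodic per (suc s) ⟩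
    ∑ m α ∎
    where open ≡-Reasoning

  -- The boundary of the shift whose first part has index `s`.
  window : (ℕ → ℕ) → ℕ → ℕ → ℕ
  window α s y = ∑[ i < y ] α (i + s)

  window-mono : ∀ α s → Monotone (window α s)
  window-mono α s = ∑-mono _

  -- arm α m′ p o z = o + α (p − 1) + ... + α (p − z), for α of period m′ + 1: subtracting d
  -- from an index is written as adding d m′.
  arm : (ℕ → ℕ) → ℕ → ℕ → ℕ → ℕ → ℕ
  arm α m′ p o z = o + (∑[ d < z ] α (p + suc d * m′))

  arm-mono : ∀ α m′ p o → Monotone (arm α m′ p o)
  arm-mono α m′ p o le = +-monoʳ-≤ o (∑-mono _ le)

  arm-periodic : ∀ {α m′} → Periodic (suc m′) α → ∀ p o z → arm α m′ (p + suc m′) o z ≡ arm α m′ p o z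
  arm-periodic {α} {m′} per p o z = cong (o +_) (∑-cong z λ d → trans
    (cong α (rearrange p (suc m′) (suc d * m′))) (per (p + suc d * m′)))
    where
    rearrange : ∀ x y z → x + y + z ≡ x + z + y
    rearrange = solve-∀

  arm-periodic-* : ∀ {α m′} → Periodic (suc m′) α → ∀ n p o z → arm α m′ (p + n * suc m′) o z ≡ arm α m′ p o z
  arm-periodic-* {α} {m′} per n p o z = periodic-* {α = λ p → arm α m′ p o z} (λ p → arm-periodic per p o z) n p

  -- The parts that `arm` collects backwards from index `q + s` are the last `y` of the first `q`
  -- parts of the window. This supplies the half-turn hypothesis of `convolve≡backward`.
  window+arm : ∀ {α m′} → Periodic (suc m′) α → ∀ s o {y q} → y ≤ q →
    window α s (q ∸ y) + arm α m′ (q + s) o y ≡ window α s q + o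
  window+arm {α} {m′} per s o {y} {q} y≤q = begin
    window α s e + (o + (∑[ d < y ] α (q + s + suc d * m′)))
      ≡⟨ cong (λ v → window α s e + (o + v)) (∑-cong< y index) ⟩
    window α s e + (o + (∑[ d < y ] α (e + (y ∸ suc d) + s)))
      ≡⟨ cong (λ v → window α s e + (o + v)) (∑-reverse y (λ i → α (e + i + s))) ⟨
    window α s e + (o + (∑[ i < y ] α (e + i + s)))
      ≡⟨ rearrange (window α s e) o _ ⟩
    window α s e + (∑[ i < y ] α (e + i + s)) + o
      ≡⟨ cong (_+ o) (∑-split e y _) ⟨
    window α s (e + y) + o
      ≡⟨ cong (λ v → window α s v + o) (m∸n+n≡m y≤q) ⟩
    window α s q + o ∎
    where
    open ≡-Reasoning
    e = q ∸ y
    rearrange : ∀ x y z → x + (y + z) ≡ x + z + y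
    rearrange = solve-∀
    unfold : ∀ e t d s m′ → e + (suc d + t) + s + suc d * m′ ≡ e + t + s + suc d * suc m′
    unfold = solve-∀
    index : ∀ d → d < y → α (q + s + suc d * m′) ≡ α (e + (y ∸ suc d) + s)
    index d d<y = begin
      α (q + s + suc d * m′)
        ≡⟨ cong (λ v → α (v + s + suc d * m′)) (m∸n+n≡m y≤q) ⟨
      α (e + y + s + suc d * m′)
        ≡⟨ cong (λ v → α (e + v + s + suc d * m′)) (m+[n∸m]≡n d<y) ⟨
      α (e + (suc d + (y ∸ suc d)) + s + suc d * m′)
        ≡⟨ cong α (unfold e (y ∸ suc d) d s m′) ⟩
      α (e + (y ∸ suc d) + s + suc d * suc m′)
        ≡⟨ periodic-* per (suc d) _ ⟩
      α (e + (y ∸ suc d) + s) ∎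

  window+o≡arm : ∀ {α m′} → Periodic (suc m′) α → ∀ s o q → window α s q + o ≡ arm α m′ (q + s) o q
  window+o≡arm {α} {m′} per s o q = trans
    (sym (window+arm per s o (≤-refl {q})))
    (cong (λ v → window α s v + arm α m′ (q + s) o q) (n∸n≡0 q))

  -- The bad chains whose unit belongs to the part of index `p` in the unshifted sequence, when that
  -- part stands in row `q`. The shift enters only through `p` and `q`.
  unitBad : (ℕ → ℕ) → ℕ → ℕ → ℕ → ℕ → ℕ → ℕ → ℕ
  unitBad α m′ k l r q p =
    ∑[ o < α p ] backward (arm α m′ p o) q (weight k l (arm α m′ p o q) q) r 0 0

  unitBad-periodic : ∀ {α m′} → Periodic (suc m′) α → ∀ k l r q → Periodic (suc m′) (unitBad α m′ k l r q)
  unitBad-periodic {α} {m′} per k l r q p = trans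
    (cong (λ n → ∑ n λ o → backward (arm α m′ (p + suc m′) o) q (weight k l (arm α m′ (p + suc m′) o q) q) r 0 0) (per p))
    (∑-cong (α p) λ o → backward-cong q (arm-periodic per p o)
      (λ s → cong (λ v → weight k l v q s) (arm-periodic per p o q)) r 0 0)

  bad-by-unit-backward : ∀ {α m′} → Periodic (suc m′) α → ∀ k l r s → window α s l ≤ k →
    ∑[ x < k ] ∑[ y < l ] (bad (window α s) x y * convolve (window α s) (chainsTo k l x y) r one x y) ≡
    ∑[ q < l ] unitBad α m′ k l r q (q + s)
  bad-by-unit-backward {α} {m′} per k l r s le = trans
    (bad-by-unit refl (window-mono α s) k l r (λ q → α (q + s)) (λ q → ∑-last q _) le)
    (∑-cong l λ q → ∑-cong (α (q + s)) λ o → trans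
      (cong (λ v → convolve F (weight k l v q) r one v q) (window+o≡arm per s o q))
      (convolve≡backward F (arm α m′ (q + s) o) q
        (λ y y≤q → trans (window+arm per s o y≤q) (window+o≡arm per s o q))
        (weight k l (arm α m′ (q + s) o q) q) r 0 0))
    where
    F : ℕ → ℕ
    F = window α s

  -- For a fixed unit, all rows `q` together give every choice of columns and rows by `∑-backward`,
  -- so each of the `α p` units contributes the same number.
  ∑-unitBad : ∀ {α m′} → Periodic (suc m′) α → ∀ K l r → (∀ s → window α s l ≤ suc K) → ∀ p →
    ∑[ q < l ] unitBad α m′ (suc K) l r q p ≡ α p * ((K C r) * (suc l C suc (suc r)))
  ∑-unitBad {α} {m′} per K l r le p = begin
    ∑[ q < l ] ∑[ o < α p ] B o q
      ≡⟨ ∑-swap l (α p) (λ q o → B o q) ⟩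
    ∑[ o < α p ] ∑[ q < l ] B o q
      ≡⟨ ∑-cong< (α p) (λ o o<αp → trans
           (∑-cong l λ q → sym (⟦⟧-true-* (0 ≤? q) z≤n _))
           (∑-backward K l (arm-mono α m′ p o) (arm≤ o o<αp) r 0 0 z≤n)) ⟩
    ∑[ o < α p ] ((K C r) * (suc l C suc (suc r)))
      ≡⟨ ∑-const (α p) _ ⟩
    α p * ((K C r) * (suc l C suc (suc r))) ∎
    where
    open ≡-Reasoning
    B : ℕ → ℕ → ℕ
    B o q = backward (arm α m′ p o) q (weight (suc K) l (arm α m′ p o q) q) r 0 0
    index : ∀ p q m′ → q + (p + q * m′) ≡ p + q * suc m′
    index = solve-∀
    arm≤ : ∀ o → o < α p → ∀ q → q < l → arm α m′ p o q ≤ K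
    arm≤ o o<αp q q<l = ≤-pred (≤-trans
      (≤-reflexive (cong suc (sym eq)))
      (≤-trans (+-monoʳ-< (window α s q) o<)
      (≤-trans (≤-reflexive (sym (∑-last q λ i → α (i + s))))
      (≤-trans (window-mono α s q<l) (le s)))))
      where
      -- This start is congruent to `p - q` modulo the period, so part `p` stands in row `q`; the
      -- bound for this shift then confines the unit.
      s = p + q * m′
      eq : window α s q + o ≡ arm α m′ p o q
      eq = trans (window+o≡arm per s o q)
        (trans (cong (λ v → arm α m′ v o q) (index p q m′)) (arm-periodic-* per q p o q))
      o< : o < α (q + s)
      o< = subst (o <_) (sym (trans (cong α (index p q m′)) (periodic-* per q p))) o<αp

  cyclic-count : ∀ {α m′} → Periodic (suc m′) α → ∀ K l r → (∀ s → window α s l ≤ suc K) →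
    (∑[ j < suc m′ ] extendⁿ (window α (suc m′ ∸ j)) (suc r) one (suc K) l)
      + ∑ (suc m′) α * ((K C r) * (suc l C suc (suc r)))
    ≡ suc m′ * chains (suc K) l (suc r) 0 0
  cyclic-count {α} {m′} per K l r le = begin
    G + ∑ m α * c
      ≡⟨ cong (G +_) (∑-*ʳ m c α) ⟨
    G + (∑[ p < m ] (α p * c))
      ≡⟨ cong (G +_) (∑-cong m λ p → sym (∑-unitBad per K l r le p)) ⟩
    G + (∑[ p < m ] ∑[ q < l ] U q p)
      ≡⟨ cong (G +_) (∑-swap m l λ p q → U q p) ⟩
    G + (∑[ q < l ] ∑[ p < m ] U q p)
      -- For fixed `q`, each part stands in row `q` under exactly one shift, so the sum over parts
      -- becomes a sum over shifts.
      ≡⟨ cong (G +_) (∑-cong l λ q → sym (∑-periodic-reverse (unitBad-periodic per k l r q) q)) ⟩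
    G + (∑[ q < l ] ∑[ j < m ] U q (q + (m ∸ j)))
      ≡⟨ cong (G +_) (∑-swap l m λ q j → U q (q + (m ∸ j))) ⟩
    G + (∑[ j < m ] ∑[ q < l ] U q (q + (m ∸ j)))
      ≡⟨ ∑-+ m (λ j → extendⁿ (F j) (suc r) one k l) (λ j → ∑[ q < l ] U q (q + (m ∸ j))) ⟨
    ∑[ j < m ] (extendⁿ (F j) (suc r) one k l + (∑[ q < l ] U q (q + (m ∸ j))))
      ≡⟨ ∑-cong m (λ j → cong (extendⁿ (F j) (suc r) one k l +_)
           (sym (bad-by-unit-backward per k l r (m ∸ j) (le (m ∸ j))))) ⟩
    ∑[ j < m ] (extendⁿ (F j) (suc r) one k l
      + (∑[ x < k ] ∑[ y < l ] (bad (F j) x y * convolve (F j) (chainsTo k l x y) r one x y)))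
      ≡⟨ ∑-cong m (λ j → sym (first-bad (F j) k l r one)) ⟩
    ∑[ j < m ] ∑[ x < k ] ∑[ y < l ] (1 * chains k l r (suc x) (suc y))
      ≡⟨ ∑-cong m (λ _ → total) ⟩
    ∑[ j < m ] chains k l (suc r) 0 0
      ≡⟨ ∑-const m _ ⟩
    m * chains k l (suc r) 0 0 ∎
    where
    open ≡-Reasoning
    m = suc m′
    k = suc K
    c = (K C r) * (suc l C suc (suc r))
    F : ℕ → ℕ → ℕ
    F j = window α (m ∸ j)
    U : ℕ → ℕ → ℕ
    U = unitBad α m′ k l r
    G : ℕ
    G = ∑[ j < m ] extendⁿ (F j) (suc r) one k l
    total : ∑[ x < k ] ∑[ y < l ] (1 * chains k l r (suc x) (suc y)) ≡ chains k l (suc r) 0 0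
    total = trans
      (∑-cong k λ x → trans
        (∑-cong l λ y → trans (*-identityˡ (T x y)) (sym (⟦⟧-true-* (0 ≤? y) z≤n (T x y))))
        (sym (⟦⟧-true-* (0 ≤? x) z≤n _)))
      (upper-chains k l r 0 0)
      where
      T : ℕ → ℕ → ℕ
      T x y = chains k l r (suc x) (suc y)

  -- Words as chains of corners

  ↔-Fin-≡ : {A : Set} {m n : ℕ} → m ≡ n → A ↔ Fin m → A ↔ Fin n
  ↔-Fin-≡ {A} = subst (λ n → A ↔ Fin n)

  empty↔Fin0 : {A : Set} → ¬ A → A ↔ Fin 0
  empty↔Fin0 ¬a = mk↔ₛ′ (λ a → ⊥-elim (¬a a)) (λ ()) (λ ()) (λ a → ⊥-elim (¬a a))

  point↔Fin1 : {A : Set} → A → Irrelevant A → A ↔ Fin 1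
  point↔Fin1 a irr = mk↔ₛ′ (λ _ → zero) (λ _ → a) (λ { zero → refl }) (irr a)

  _⊎-Fin_ : {A B : Set} {m n : ℕ} → A ↔ Fin m → B ↔ Fin n → (A ⊎ B) ↔ Fin (m + n)
  f ⊎-Fin g = ↔-trans (f ⊎-↔ g) (↔-sym +↔⊎)

  guard : {A P : Set} {n : ℕ} (P? : Dec P) → (P → A ↔ Fin n) → (¬ P → ¬ A) → A ↔ Fin (⟦ P? ⟧ * n)
  guard {n = n} (yes p) iso _    = ↔-Fin-≡ (sym (*-identityˡ n)) (iso p)
  guard         (no ¬p) _   none = empty↔Fin0 (none ¬p)

  Σ-Fin : ∀ m (N : ℕ → ℕ) {B : Fin m → Set} → (∀ j → B j ↔ Fin (N (toℕ j))) → Σ (Fin m) B ↔ Fin (∑ m N)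
  Σ-Fin zero    N isos = empty↔Fin0 λ ()
  Σ-Fin (suc m) N {B} isos = ↔-trans
    (mk↔ₛ′ to from (λ { (inj₁ _) → refl ; (inj₂ _) → refl }) (λ { (zero , _) → refl ; (suc _ , _) → refl }))
    (isos zero ⊎-Fin Σ-Fin m (N ∘ suc) (isos ∘ suc))
    where
    to : Σ (Fin (suc m)) B → B zero ⊎ Σ (Fin m) (B ∘ suc)
    to (zero , b)  = inj₁ b
    to (suc j , b) = inj₂ (j , b)
    from : B zero ⊎ Σ (Fin m) (B ∘ suc) → Σ (Fin (suc m)) B
    from (inj₁ b)       = zero , b
    from (inj₂ (j , b)) = suc j , b

  Σ-⇔ : {A : Set} {P Q : A → Set} → (∀ x → Irrelevant (P x)) → (∀ x → Irrelevant (Q x)) →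
    (∀ {x} → P x → Q x) → (∀ {x} → Q x → P x) → Σ A P ↔ Σ A Q
  Σ-⇔ irrP irrQ to from = mk↔ₛ′
    (λ (x , p) → x , to p) (λ (x , q) → x , from q)
    (λ (x , q) → cong (x ,_) (irrQ x _ _)) (λ (x , p) → cong (x ,_) (irrP x _ _))

  split-first : (Q : List Step → Set) →
    Σ (List Step) Q ↔ (Q [] ⊎ (Σ (List Step) (Q ∘ (right ∷_)) ⊎ Σ (List Step) (Q ∘ (up ∷_))))
  split-first Q = mk↔ₛ′ to from
    (λ { (inj₁ _) → refl ; (inj₂ (inj₁ _)) → refl ; (inj₂ (inj₂ _)) → refl })
    (λ { ([] , _) → refl ; (right ∷ _ , _) → refl ; (up ∷ _ , _) → refl })
    where
    to : Σ (List Step) Q → Q [] ⊎ (Σ (List Step) (Q ∘ (right ∷_)) ⊎ Σ (List Step) (Q ∘ (up ∷_)))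
    to ([] , q)        = inj₁ q
    to (right ∷ P , q) = inj₂ (inj₁ (P , q))
    to (up ∷ P , q)    = inj₂ (inj₂ (P , q))
    from : Q [] ⊎ (Σ (List Step) (Q ∘ (right ∷_)) ⊎ Σ (List Step) (Q ∘ (up ∷_))) → Σ (List Step) Q
    from (inj₁ q)              = [] , q
    from (inj₂ (inj₁ (P , q))) = right ∷ P , q
    from (inj₂ (inj₂ (P , q))) = up ∷ P , q

  endFrom-≥ˣ : ∀ x y P → x ≤ proj₁ (endFrom (x , y) P)
  endFrom-≥ˣ x y []          = ≤-refl
  endFrom-≥ˣ x y (up ∷ P)    = endFrom-≥ˣ x (suc y) P
  endFrom-≥ˣ x y (right ∷ P) = <⇒≤ (endFrom-≥ˣ (suc x) y P)

  endFrom-≥ʸ : ∀ x y P → y ≤ proj₂ (endFrom (x , y) P)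
  endFrom-≥ʸ x y []          = ≤-refl
  endFrom-≥ʸ x y (up ∷ P)    = <⇒≤ (endFrom-≥ʸ x (suc y) P)
  endFrom-≥ʸ x y (right ∷ P) = endFrom-≥ʸ (suc x) y P

  ≟+<?≡1 : ∀ {x k} → x ≤ k → ⟦ x ≟ k ⟧ + ⟦ x <? k ⟧ ≡ 1
  ≟+<?≡1 {x} {k} x≤k with x ≟ k | x <? k
  ... | yes refl | yes x<x = ⊥-elim (<-irrefl refl x<x)
  ... | yes _    | no _    = refl
  ... | no _     | yes _   = refl
  ... | no x≢k   | no x≮k  = ⊥-elim (x≮k (≤∧≢⇒< x≤k x≢k))

  module _ (F : ℕ → ℕ) (k l : ℕ) where

    -- Chains whose first point has a settled column but an open row: the state of a path that is
    -- climbing.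
    column : ℕ → ℕ → ℕ → ℕ
    column c x b = ∑[ y < l ] (⟦ b ≤? y ⟧ * (good F x y * goodChains F k l c (suc x) (suc y)))

    column-guard : ∀ c x b → ⟦ b <? l ⟧ * column c x b ≡ column c x b
    column-guard c x b with b <? l
    ... | yes _   = *-identityˡ _
    ... | no b≮l = sym (∑-from-≥ (≮⇒≥ b≮l) _)

    column-step : ∀ c {x b} → b < l → F (suc b) ≤ x →
      column c x b ≡ goodChains F k l c (suc x) (suc b) + column c x (suc b)
    column-step c {x} {b} b<l F≤x = trans
      (∑-from-head b<l λ y → good F x y * goodChains F k l c (suc x) (suc y))
      (cong (_+ column c x (suc b)) (⟦⟧-true-* (F (suc b) ≤? x) F≤x _))

    -- A bad point makes all points above it in its column bad.
    column-zero : Monotone F → ∀ c {x b} → ¬ F (suc b) ≤ x → column c x b ≡ 0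
    column-zero mono c {x} {b} F≰x = ∑-zero l λ y _ → zero-term y
      where
      zero-term : ∀ y → ⟦ b ≤? y ⟧ * (good F x y * goodChains F k l c (suc x) (suc y)) ≡ 0
      zero-term y with b ≤? y
      ... | yes b≤y = cong (1 *_) (⟦⟧-false-* (F (suc y) ≤? x) (λ le → F≰x (≤-trans (mono (s≤s b≤y)) le)) _)
      ... | no _    = refl

    nilCount : ℕ → ℕ → ℕ → ℕ
    nilCount x y c = ⟦ x ≟ k ⟧ * (⟦ y ≟ l ⟧ * (⟦ 0 ≟ c ⟧ * 1))

    -- After an up step, every later right step closes a corner in the current column.
    afterUp : ℕ → ℕ → ℕ → ℕ
    afterUp zero    x y = ⟦ x ≟ k ⟧
    afterUp (suc c) x y = ⟦ x <? k ⟧ * column c x y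

    turnRight : ℕ → ℕ → ℕ → ℕ
    turnRight zero    x y = 0
    turnRight (suc c) x y = ⟦ x <? k ⟧ * goodChains F k l c (suc x) (suc y)

    -- The path stops, goes right or goes up. With no corners left it must run right to column `k`
    -- before it climbs.
    goodChains-step : ∀ c {x y} → x ≤ k → y ≤ l →
      nilCount x y c + (⟦ x <? k ⟧ * goodChains F k l c (suc x) y + ⟦ y <? l ⟧ * afterUp c x y) ≡
      goodChains F k l c x y
    goodChains-step zero {x} {y} x≤k y≤l = begin
      A * (B * (1 * 1)) + (A′ * 1 + B′ * A)    ≡⟨ rearrange A B A′ B′ ⟩
      A * (B + B′) + A′                        ≡⟨ cong (λ v → A * v + A′) (≟+<?≡1 y≤l) ⟩
      A * 1 + A′                               ≡⟨ cong (_+ A′) (*-identityʳ A) ⟩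
      A + A′                                   ≡⟨ ≟+<?≡1 x≤k ⟩
      1 ∎
      where
      open ≡-Reasoning
      A = ⟦ x ≟ k ⟧
      B = ⟦ y ≟ l ⟧
      A′ = ⟦ x <? k ⟧
      B′ = ⟦ y <? l ⟧
      rearrange : ∀ a b a′ b′ → a * (b * (1 * 1)) + (a′ * 1 + b′ * a) ≡ a * (b + b′) + a′
      rearrange = solve-∀
    goodChains-step (suc c) {x} {y} x≤k y≤l = begin
      A * (B * 0) + (A′ * G′ + B′ * (A′ * column c x y))  ≡⟨ rearrange A B A′ G′ B′ (column c x y) ⟩
      A′ * (B′ * column c x y + G′)                       ≡⟨ cong (λ v → A′ * (v + G′)) (column-guard c x y) ⟩
      A′ * (column c x y + G′)                            ≡⟨ head ⟩
      goodChains F k l (suc c) x y ∎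
      where
      open ≡-Reasoning
      A = ⟦ x ≟ k ⟧
      B = ⟦ y ≟ l ⟧
      A′ = ⟦ x <? k ⟧
      B′ = ⟦ y <? l ⟧
      G′ = goodChains F k l (suc c) (suc x) y
      rearrange : ∀ a b a′ g b′ t → a * (b * 0) + (a′ * g + b′ * (a′ * t)) ≡ a′ * (b′ * t + g)
      rearrange = solve-∀
      head : ⟦ x <? k ⟧ * (column c x y + G′) ≡ goodChains F k l (suc c) x y
      head with x <? k
      ... | yes x<k = trans (*-identityˡ _) (sym (∑-from-head x<k λ x → column c x y))
      ... | no x≮k  = sym (∑-from-≥ (≮⇒≥ x≮k) _)

    -- The path stands at `(x , suc y)`: it stops, turns right and so makes the corner encoded by
    -- `(x , y)`, or climbs on.
    afterUp-step : ∀ c {x y} → y < l → F (suc y) ≤ x →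
      nilCount x (suc y) c + (turnRight c x y + ⟦ suc y <? l ⟧ * afterUp c x (suc y)) ≡ afterUp c x y
    afterUp-step zero {x} {y} y<l F≤x = begin
      A * (B * (1 * 1)) + (0 + B′ * A)    ≡⟨ rearrange A B B′ ⟩
      A * (B + B′)                        ≡⟨ cong (A *_) (≟+<?≡1 y<l) ⟩
      A * 1                               ≡⟨ *-identityʳ A ⟩
      A ∎
      where
      open ≡-Reasoning
      A = ⟦ x ≟ k ⟧
      B = ⟦ suc y ≟ l ⟧
      B′ = ⟦ suc y <? l ⟧
      rearrange : ∀ a b b′ → a * (b * (1 * 1)) + (0 + b′ * a) ≡ a * (b + b′)
      rearrange = solve-∀
    afterUp-step (suc c) {x} {y} y<l F≤x = begin
      A * (B * 0) + (A′ * G′ + B′ * (A′ * column c x (suc y)))  ≡⟨ rearrange A B A′ G′ B′ (column c x (suc y)) ⟩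
      A′ * (G′ + B′ * column c x (suc y))                       ≡⟨ cong (λ v → A′ * (G′ + v)) (column-guard c x (suc y)) ⟩
      A′ * (G′ + column c x (suc y))                            ≡⟨ cong (A′ *_) (column-step c y<l F≤x) ⟨
      A′ * column c x y ∎
      where
      open ≡-Reasoning
      A = ⟦ x ≟ k ⟧
      B = ⟦ suc y ≟ l ⟧
      A′ = ⟦ x <? k ⟧
      B′ = ⟦ suc y <? l ⟧
      G′ = goodChains F k l c (suc x) (suc y)
      rearrange : ∀ a b a′ g b′ t → a * (b * 0) + (a′ * g + b′ * (a′ * t)) ≡ a′ * (g + b′ * t)
      rearrange = solve-∀

    -- Dominated paths, decomposed by their first step.

    module _ (mono : Monotone F) (Fl≤k : F l ≤ k) (Dom : ℕ × ℕ → Set)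
             (irrelevant : ∀ {p} → Irrelevant (Dom p))
             (sound : ∀ {x y} → Dom (x , y) → F y ≤ x)
             (complete : ∀ {x y} → y ≤ l → F y ≤ x → Dom (x , y)) where

      Path : (List Step → ℕ) → ℕ × ℕ → ℕ → List Step → Set
      Path κ p c P = endFrom p P ≡ (k , l) × All Dom (pointsFrom p P) × κ P ≡ c

      Path-irrelevant : ∀ κ p c P → Irrelevant (Path κ p c P)
      Path-irrelevant κ p c P (e , ds , q) (e′ , ds′ , q′) =
        cong₂ _,_ (uip e e′) (cong₂ _,_ (All.irrelevant irrelevant ds ds′) (uip q q′))

      -- The preceding up step is restored, since it makes an initial right step count as a corner.
      cornersAfterUp : List Step → ℕ
      cornersAfterUp P = corners (up ∷ P)

      nil↔Fin : ∀ κ {x y c} → κ [] ≡ 0 → Dom (x , y) → Path κ (x , y) c [] ↔ Fin (nilCount x y c)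
      nil↔Fin κ {x} {y} {c} κ[]≡0 dom =
        guard (x ≟ k) (λ x≡k → guard (y ≟ l) (λ y≡l → guard (0 ≟ c)
          (λ 0≡c → point↔Fin1 (cong₂ _,_ x≡k y≡l , dom ∷ [] , trans κ[]≡0 0≡c) (Path-irrelevant κ (x , y) c []))
          λ 0≢c (_ , _ , q) → 0≢c (trans (sym κ[]≡0) q))
          λ y≢l (e , _) → y≢l (cong proj₂ e))
          λ x≢k (e , _) → x≢k (cong proj₁ e)

      right↔ : ∀ {x y c} → Dom (x , y) →
        Σ (List Step) (Path corners (x , y) c ∘ (right ∷_)) ↔ Σ (List Step) (Path corners (suc x , y) c)
      right↔ {x} {y} {c} dom = Σ-⇔
        (Path-irrelevant corners (x , y) c ∘ (right ∷_)) (Path-irrelevant corners (suc x , y) c)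
        (λ { (e , _ ∷ ds , q) → e , ds , q }) (λ { (e , ds , q) → e , dom ∷ ds , q })

      corner↔ : ∀ {x y c} → Dom (x , y) →
        Σ (List Step) (Path cornersAfterUp (x , y) (suc c) ∘ (right ∷_)) ↔ Σ (List Step) (Path corners (suc x , y) c)
      corner↔ {x} {y} {c} dom = Σ-⇔
        (Path-irrelevant cornersAfterUp (x , y) (suc c) ∘ (right ∷_)) (Path-irrelevant corners (suc x , y) c)
        (λ { (e , _ ∷ ds , q) → e , ds , suc-injective q }) (λ { (e , ds , q) → e , dom ∷ ds , cong suc q })

      up↔ : ∀ {x y c} → Dom (x , y) →
        Σ (List Step) (Path corners (x , y) c ∘ (up ∷_)) ↔ Σ (List Step) (Path cornersAfterUp (x , suc y) c)
      up↔ {x} {y} {c} dom = Σ-⇔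
        (Path-irrelevant corners (x , y) c ∘ (up ∷_)) (Path-irrelevant cornersAfterUp (x , suc y) c)
        (λ { (e , _ ∷ ds , q) → e , ds , q }) (λ { (e , ds , q) → e , dom ∷ ds , q })

      upAfterUp↔ : ∀ {x y c} → Dom (x , y) →
        Σ (List Step) (Path cornersAfterUp (x , y) c ∘ (up ∷_)) ↔ Σ (List Step) (Path cornersAfterUp (x , suc y) c)
      upAfterUp↔ {x} {y} {c} dom = Σ-⇔
        (Path-irrelevant cornersAfterUp (x , y) c ∘ (up ∷_)) (Path-irrelevant cornersAfterUp (x , suc y) c)
        (λ { (e , _ ∷ ds , q) → e , ds , q }) (λ { (e , ds , q) → e , dom ∷ ds , q })

      no-right : ∀ {κ x y c} → ¬ x < k → ¬ Σ (List Step) (Path κ (suc x , y) c)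
      no-right {x = x} {y} x≮k (P , e , _) =
        x≮k (subst (suc x ≤_) (cong proj₁ e) (endFrom-≥ˣ (suc x) y P))

      no-up : ∀ {κ x y c} → ¬ y < l → ¬ Σ (List Step) (Path κ (x , suc y) c)
      no-up {x = x} {y} y≮l (P , e , _) =
        y≮l (subst (suc y ≤_) (cong proj₂ e) (endFrom-≥ʸ x (suc y) P))

      -- dx and dy are the numbers of right and up steps still to be made.
      paths↔Fin : ∀ dx dy {x y} → x + dx ≡ k → y + dy ≡ l → Dom (x , y) → ∀ c →
        Σ (List Step) (Path corners (x , y) c) ↔ Fin (goodChains F k l c x y)
      pathsAfterUp↔Fin : ∀ dx dy {x y} → x + dx ≡ k → suc y + dy ≡ l → ∀ c →
        Σ (List Step) (Path cornersAfterUp (x , suc y) c) ↔ Fin (afterUp c x y)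
      stepRight : ∀ dx dy {x y} → x + dx ≡ k → y + dy ≡ l → Dom (x , y) → ∀ c →
        Σ (List Step) (Path corners (suc x , y) c) ↔ Fin (⟦ x <? k ⟧ * goodChains F k l c (suc x) y)
      stepUp : ∀ dx dy {x y} → x + dx ≡ k → y + dy ≡ l → ∀ c →
        Σ (List Step) (Path cornersAfterUp (x , suc y) c) ↔ Fin (⟦ y <? l ⟧ * afterUp c x y)

      paths↔Fin dx dy {x} {y} ex ey dom c = ↔-Fin-≡
        (goodChains-step c (m+n≤o⇒m≤o x (≤-reflexive ex)) (m+n≤o⇒m≤o y (≤-reflexive ey)))
        (↔-trans (split-first (Path corners (x , y) c))
          (nil↔Fin corners refl dom
            ⊎-Fin (↔-trans (right↔ dom) (stepRight dx dy ex ey dom c)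
            ⊎-Fin ↔-trans (up↔ dom) (stepUp dx dy ex ey c))))

      pathsAfterUp↔Fin dx dy {x} {y} ex ey c with F (suc y) ≤? x
      ... | no F≰x = ↔-Fin-≡ (sym (none c)) (empty↔Fin0 λ { ([] , _ , d ∷ _ , _) → F≰x (sound d)
                                                          ; (up ∷ _ , _ , d ∷ _ , _) → F≰x (sound d)
                                                          ; (right ∷ _ , _ , d ∷ _ , _) → F≰x (sound d) })
        where
        y<l : y < l
        y<l = m+n≤o⇒m≤o (suc y) (≤-reflexive ey)
        none : ∀ c → afterUp c x y ≡ 0
        -- In column `k` the boundary at row `suc y` is at most `F l`, hence at most `k`, so a bad
        -- point cannot lie there.
        none zero    = ⟦⟧-false (x ≟ k) λ x≡k → F≰x (≤-trans (mono y<l) (≤-trans Fl≤k (≤-reflexive (sym x≡k))))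
        none (suc c) = trans (cong (⟦ x <? k ⟧ *_) (column-zero mono c F≰x)) (*-zeroʳ ⟦ x <? k ⟧)
      ... | yes F≤x = ↔-Fin-≡
        (afterUp-step c y<l F≤x)
        (↔-trans (split-first (Path cornersAfterUp (x , suc y) c))
          (nil↔Fin cornersAfterUp refl dom
            ⊎-Fin (turn c
            ⊎-Fin ↔-trans (upAfterUp↔ dom) (stepUp dx dy ex ey c))))
        where
        y<l : y < l
        y<l = m+n≤o⇒m≤o (suc y) (≤-reflexive ey)
        dom : Dom (x , suc y)
        dom = complete y<l F≤x
        turn : ∀ c → Σ (List Step) (Path cornersAfterUp (x , suc y) c ∘ (right ∷_)) ↔ Fin (turnRight c x y)
        turn zero    = empty↔Fin0 λ { (_ , _ , _ , ()) }
        turn (suc c) = ↔-trans (corner↔ dom) (stepRight dx dy ex ey dom c)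

      stepRight zero     dy {x} {y} ex ey dom c = guard (x <? k)
        (λ x<k → ⊥-elim (<-irrefl (trans (sym (+-identityʳ x)) ex) x<k)) no-right
      stepRight (suc dx) dy {x} {y} ex ey dom c = guard (x <? k)
        (λ _ → paths↔Fin dx dy (trans (sym (+-suc x dx)) ex) ey
          (complete (m+n≤o⇒m≤o y (≤-reflexive ey)) (≤-trans (sound dom) (n≤1+n x))) c) no-right

      stepUp dx zero     {x} {y} ex ey c = guard (y <? l)
        (λ y<l → ⊥-elim (<-irrefl (trans (sym (+-identityʳ y)) ey) y<l)) no-up
      stepUp dx (suc dy) {x} {y} ex ey c = guard (y <? l)
        (λ _ → pathsAfterUp↔Fin dx dy ex (trans (sym (+-suc y dy)) ey) c) no-up

  -- The composition as a periodic sequence.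

  sum-take : ∀ {m} (b : Fin m → ℕ) (β : ℕ → ℕ) → (∀ i → b i ≡ β (toℕ i)) → ∀ {y} → y ≤ m →
    sum (take y (tabulate b)) ≡ ∑ y β
  sum-take         b β e {zero}  _         = refl
  sum-take {suc m} b β e {suc y} (s≤s y≤m) = cong₂ _+_ (e zero) (sum-take (b ∘ suc) (β ∘ suc) (e ∘ suc) y≤m)

  sum-tabulate : ∀ {m} (b : Fin m → ℕ) (β : ℕ → ℕ) → (∀ i → b i ≡ β (toℕ i)) → sum (tabulate b) ≡ ∑ m β
  sum-tabulate {zero}  b β e = refl
  sum-tabulate {suc m} b β e = cong₂ _+_ (e zero) (sum-tabulate (b ∘ suc) (β ∘ suc) (e ∘ suc))

  periodicExtension : ∀ {m′} → (Fin (suc m′) → ℕ) → ℕ → ℕ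
  periodicExtension {m′} a i = a (i mod suc m′)

  periodicExtension-periodic : ∀ {m′} (a : Fin (suc m′) → ℕ) → Periodic (suc m′) (periodicExtension a)
  periodicExtension-periodic {m′} a x = cong a (toℕ-injective (begin
    toℕ ((x + suc m′) mod suc m′)   ≡⟨ toℕ-fromℕ< (m%n<n (x + suc m′) (suc m′)) ⟩
    (x + suc m′) % suc m′           ≡⟨ [m+n]%n≡m%n x (suc m′) ⟩
    x % suc m′                      ≡⟨ toℕ-fromℕ< (m%n<n x (suc m′)) ⟨
    toℕ (x mod suc m′) ∎))
    where open ≡-Reasoning

  periodicExtension-toℕ : ∀ {m′} (a : Fin (suc m′) → ℕ) i → a i ≡ periodicExtension a (toℕ i)
  periodicExtension-toℕ {m′} a i = cong a (toℕ-injective (sym (trans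
    (toℕ-fromℕ< (m%n<n (toℕ i) (suc m′)))
    (m<n⇒m%n≡m (toℕ<n i)))))

  f-shift : ∀ {m′} (a : Fin (suc m′) → ℕ) j {y} → y ≤ suc m′ →
    f (shift a j) y ≡ window (periodicExtension a) (suc m′ ∸ toℕ j) y
  f-shift {m′} a j = sum-take (shift a j) (λ i → periodicExtension a (i + (suc m′ ∸ toℕ j))) λ _ → refl

  window-≤ : ∀ {m′ l k} {α : ℕ → ℕ} → Periodic (suc m′) α →
    (∀ (j : Fin (suc m′)) → window α (suc m′ ∸ toℕ j) l ≤ k) → ∀ s → window α s l ≤ k
  window-≤ {m′} {l} {k} {α} per le s = subst (_≤ k) (∑-cong l index) (le j)
    where
    open ≡-Reasoning
    m = suc m′
    -- The starts `m ∸ toℕ j` run through 1 to `m`, not 0 to `m′`; adding `m′` first makes `suc r`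
    -- the representative of `s` in that range.
    r = (s + m′) % m
    j : Fin m
    j = fromℕ< (s≤s (m∸n≤m m′ r))
    offset : m ∸ toℕ j ≡ suc r
    offset = begin
      m ∸ toℕ j             ≡⟨ cong (m ∸_) (toℕ-fromℕ< (s≤s (m∸n≤m m′ r))) ⟩
      suc m′ ∸ (m′ ∸ r)     ≡⟨ +-∸-assoc 1 (m∸n≤m m′ r) ⟩
      suc (m′ ∸ (m′ ∸ r))   ≡⟨ cong suc (m∸[m∸n]≡n (≤-pred (m%n<n (s + m′) m))) ⟩
      suc r ∎
    rearrange₁ : ∀ i r x → i + suc r + x ≡ suc i + (r + x)
    rearrange₁ = solve-∀
    rearrange₂ : ∀ i s x → suc i + (s + x) ≡ i + s + suc x
    rearrange₂ = solve-∀
    index : ∀ i → α (i + (m ∸ toℕ j)) ≡ α (i + s)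
    index i = begin
      α (i + (m ∸ toℕ j))                   ≡⟨ cong (λ v → α (i + v)) offset ⟩
      α (i + suc r)                         ≡⟨ periodic-* per ((s + m′) / m) (i + suc r) ⟨
      α (i + suc r + (s + m′) / m * m)      ≡⟨ cong α (rearrange₁ i r ((s + m′) / m * m)) ⟩
      α (suc i + (r + (s + m′) / m * m))    ≡⟨ cong (λ v → α (suc i + v)) (m≡m%n+[m/n]*n (s + m′) m) ⟨
      α (suc i + (s + m′))                  ≡⟨ cong α (rearrange₂ i s m′) ⟩
      α (i + s + m)                         ≡⟨ per (i + s) ⟩
      α (i + s) ∎

  cyclic-goodChains : ∀ {m′} (a : Fin (suc m′) → ℕ) K l r → l ≤ suc m′ →
    (∀ j → DominatedPt (shift a j) (suc K , l)) →
    (∑[ j < suc m′ ] goodChains (window (periodicExtension a) (suc m′ ∸ j)) (suc K) l (suc r) 0 0)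
      + sum (tabulate a) * ((K C r) * (suc l C suc (suc r)))
    ≡ suc m′ * ((suc K C suc r) * (l C suc r))
  cyclic-goodChains {m′} a K l r l≤m dom = trans
    (cong₂ (λ u v → u + v * ((K C r) * (suc l C suc (suc r))))
      (∑-cong (suc m′) λ j → goodChains≡extendⁿ (window (periodicExtension a) (suc m′ ∸ j)) (suc K) l r)
      (sum-tabulate a (periodicExtension a) (periodicExtension-toℕ a)))
    (cyclic-count per K l r (window-≤ {l = l} per λ j → subst (_≤ suc K) (f-shift a j l≤m) (proj₂ (dom j))))
    where
    per : Periodic (suc m′) (periodicExtension a)
    per = periodicExtension-periodic a

-- Counting good pairs and the formula over the integers.

open Counting
open import Data.Integer using (ℤ; +_; -[1+_]; _-_; _*_)
open import Data.Integer.Properties using (+-injective; +-identityʳ; +-inverseʳ; +-assoc; *-zeroʳ; *-zeroˡ; pos-*)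
import Data.Nat as ℕ
import Data.Nat.Properties as ℕ

goodCorners↔Fin : ∀ {m′} (a : Fin (suc m′) → ℕ) k l → l ≤ suc m′ → (∀ j → DominatedPt (shift a j) (k , l)) →
  ∀ c → GoodCorners (suc m′) a (k , l) (+ c) ↔
    Fin (∑[ j < suc m′ ] goodChains (window (periodicExtension a) (suc m′ ℕ.∸ j)) k l c 0 0)
goodCorners↔Fin {m′} a k l l≤m dom c = ↔-trans by-shift
  (Σ-Fin (suc m′) (λ j → goodChains (window α (suc m′ ℕ.∸ j)) k l c 0 0) λ j →
  ↔-trans (Σ-⇔ (λ P → irr j P) (λ P → irr j P)
    (λ (e , ds , q) → e , ds , +-injective q) (λ (e , ds , q) → e , ds , cong +_ q))
    (paths↔Fin (F j) k l (window-mono α _)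
      (subst (_≤ k) (f-shift a j l≤m) (proj₂ (dom j)))
      (DominatedPt (shift a j)) (dominated-irrelevant j)
      (λ {x} (y≤m , le) → subst (_≤ x) (f-shift a j y≤m) le)
      (λ {x} y≤l le → ℕ.≤-trans y≤l l≤m , subst (_≤ x) (sym (f-shift a j (ℕ.≤-trans y≤l l≤m))) le)
      k l refl refl (z≤n , z≤n) c))
  where
  α = periodicExtension a
  F : Fin (suc m′) → ℕ → ℕ
  F j = window α (suc m′ ℕ.∸ toℕ j)
  dominated-irrelevant : ∀ j {p} → Irrelevant (DominatedPt (shift a j) p)
  dominated-irrelevant j (u , v) (u′ , v′) = cong₂ _,_ (ℕ.≤-irrelevant u u′) (ℕ.≤-irrelevant v v′)
  irr : ∀ j {A : Set} {u v : A} P →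
    Irrelevant ((endpoint P ≡ (k , l)) × DominatedPath (shift a j) P × (u ≡ v))
  irr j P (e , ds , q) (e′ , ds′ , q′) =
    cong₂ _,_ (uip e e′) (cong₂ _,_ (All.irrelevant (dominated-irrelevant j) ds ds′) (uip q q′))
  Good : Fin (suc m′) → List Step → Set
  Good j P = (endpoint P ≡ (k , l)) × DominatedPath (shift a j) P × (+ corners P ≡ + c)
  by-shift : GoodCorners (suc m′) a (k , l) (+ c) ↔ Σ (Fin (suc m′)) λ j → Σ (List Step) (Good j)
  by-shift = mk↔ₛ′ (λ ((P , j) , v) → j , P , v) (λ (j , P , v) → (P , j) , v) (λ _ → refl) (λ _ → refl)

binomℤ-neg : ∀ x c → binomℤ x -[1+ c ] ≡ + 0
binomℤ-neg (+ _)    c = refl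
binomℤ-neg -[1+ _ ] c = refl

+-difference : ∀ N {X Y : ℕ} → N ℕ.+ Y ≡ X → + N ≡ + X - + Y
+-difference N {X} {Y} refl = begin
  + N                                       ≡⟨ +-identityʳ (+ N) ⟨
  + N Data.Integer.+ + 0                    ≡⟨ cong (λ v → + N Data.Integer.+ v) (+-inverseʳ (+ Y)) ⟨
  + N Data.Integer.+ (+ Y - + Y)            ≡⟨ +-assoc (+ N) (+ Y) (Data.Integer.- (+ Y)) ⟨
  + (N ℕ.+ Y) - + Y ∎
  where open ≡-Reasoning

pos-*₃ : ∀ x y z → + x * + y * + z ≡ + (x ℕ.* (y ℕ.* z))
pos-*₃ x y z = trans (cong (_* + z) (sym (pos-* x y)))
  (trans (sym (pos-* (x ℕ.* y) z)) (cong +_ (ℕ.*-assoc x y z)))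

*₃-zero : ∀ x {y} z → y ≡ + 0 → x * y * z ≡ + 0
*₃-zero x z refl = trans (cong (_* z) (*-zeroʳ x)) (*-zeroˡ z)

theorem2 : (m n : ℕ) → .{{_ : NonZero m}} → (a : Fin m → ℕ) → sum (tabulate a) ≡ n →
    (k l : ℕ) → l ≤ m → (∀ j → DominatedPt (shift a j) (k , l)) →
    (c : ℤ) →
    Σ ℕ λ N → (GoodCorners m a (k , l) c ↔ Fin N)
    × (+ N ≡ (+ m * binomℤ (+ k) c * binomℤ (+ l) c)
    - (+ n * binomℤ (+ k - + 1) (c - + 1) * binomℤ (+ l Data.Integer.+ + 1) (c Data.Integer.+ + 1)))
theorem2 zero n {{()}}
theorem2 (suc m′) n a sum≡n k l l≤m dom -[1+ c ] =
  -- No path has a negative number of corners, and on the right the lower indices `c` and `c - 1`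
  -- are both negative.
  0 , empty↔Fin0 (λ { (_ , _ , _ , ()) }) ,
  sym (cong₂ _-_
    (*₃-zero (+ suc m′) _ (binomℤ-neg (+ k) c))
    (*₃-zero (+ n) _ (binomℤ-neg (+ k - + 1) (suc (c ℕ.+ 0)))))
theorem2 (suc m′) n a sum≡n k l l≤m dom (+ c) = _ , goodCorners↔Fin a k l l≤m dom c , count k dom c
  where
  open ≡-Reasoning
  m = suc m′
  α = periodicExtension a
  N : ℕ → ℕ → ℕ
  N k c = ∑[ j < m ] goodChains (window α (m ℕ.∸ j)) k l c 0 0
  count : ∀ k → (∀ j → DominatedPt (shift a j) (k , l)) → ∀ c →
    + N k c ≡ (+ m * binomℤ (+ k) (+ c) * binomℤ (+ l) (+ c))
    - (+ n * binomℤ (+ k - + 1) (+ c - + 1) * binomℤ (+ l Data.Integer.+ + 1) (+ c Data.Integer.+ + 1))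
  -- Each shift has one path without corners; the subtrahend vanishes because its lower index is -1.
  count k dom zero = begin
    + N k 0
      ≡⟨ +-difference (N k 0) (trans (ℕ.+-identityʳ _) (trans (∑-const m 1)
           (cong (m ℕ.*_) (sym (cong₂ ℕ._*_ (nC0≡1 k) (nC0≡1 l)))))) ⟩
    + (m ℕ.* ((k C 0) ℕ.* (l C 0))) - + 0
      ≡⟨ cong₂ _-_ (pos-*₃ m (k C 0) (l C 0)) (*₃-zero (+ n) _ (binomℤ-neg (+ k - + 1) 0)) ⟨
    _ ∎
  -- Without columns there are no corners. On the right `0 C suc r` is zero, and `binomℤ` takes its
  -- default value 0 at the upper index -1.
  count zero dom (suc r) = begin
    + N 0 (suc r)
      ≡⟨ cong +_ (trans (∑-const m 0) (ℕ.*-zeroʳ m)) ⟩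
    + 0 - + 0
      ≡⟨ cong₂ _-_ (*₃-zero (+ m) _ (cong +_ (0C[1+r]≡0 r))) (*₃-zero (+ n) _ refl) ⟨
    _ ∎
  count (suc K) dom (suc r) = begin
    + N (suc K) (suc r)
      ≡⟨ +-difference (N (suc K) (suc r)) (cyclic-goodChains a K l r l≤m dom) ⟩
    + (m ℕ.* ((suc K C suc r) ℕ.* (l C suc r)))
      - + (sum (tabulate a) ℕ.* ((K C r) ℕ.* (suc l C suc (suc r))))
      ≡⟨ cong₂ _-_ (pos-*₃ m (suc K C suc r) (l C suc r)) subtrahend ⟨
    _ ∎
    where
    subtrahend : + n * + (K C r) * + ((l ℕ.+ 1) C (suc r ℕ.+ 1)) ≡
      + (sum (tabulate a) ℕ.* ((K C r) ℕ.* (suc l C suc (suc r))))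
    subtrahend = trans
      (cong₂ (λ u v → + u * + (K C r) * + v) (sym sum≡n) (cong₂ _C_ (ℕ.+-comm l 1) (ℕ.+-comm (suc r) 1)))
      (pos-*₃ (sum (tabulate a)) (K C r) _)
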